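{- Let $\ell\ge 2$ and let $G$ be the visibility graph of a set of $n\ge 2$ points in the plane, at most $\ell$ of which are collinear. Then $G$ is $\lceil\frac{n-1}{\ell-1}\rceil$-edge-connected; moreover, between each pair of distinct vertices of $G$ there are $\lceil\frac{n-1}{\ell-1}\rceil$ pairwise edge-disjoint $1$-bend paths. This bound is best possible: there exist such point sets whose visibility graph has a vertex of degree exactly $\frac{n-1}{\ell-1}$.
   Context: For a finite set $P$ of points in the plane, two distinct points $v,w$ are visible with respect to $P$ if no point of $P$ lies in the open line segment $vw$. The visibility graph of $P$ has vertex set $P$, with $v,w$ adjacent iff they are visible with respect to $P$. Edges of a visibility graph are drawn as straight segments. A $1$-bend path between $v$ and $w$ is a path in the visibility graph whose drawing is a polygonal curve from $v$ to $w$ with at most one bend, i.e. either it consists of the consecutive points of $P$ along the segment $vw$, or there is a point $x\in P$ such that the path consists of the consecutive points of $P$ along the segment $vx$ followed by those along the segment $xw$. -}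

module Defs where

open import Level using (0ℓ)
open import Data.Nat using (ℕ; zero; suc)
import Data.Nat as ℕ
open import Data.Fin using (Fin)
open import Data.Product using (Σ; ∃; ∃-syntax; _×_; _,_)
open import Data.Sum using (_⊎_)
open import Data.Maybe using (just)
open import Data.List using (List; []; _∷_; _++_; length; head; last)
open import Data.List.Membership.Propositional using (_∈_)
open import Data.List.Relation.Unary.Linked using (Linked)
open import Data.List.Relation.Unary.Unique.Propositional using (Unique)
open import Data.List.Relation.Unary.All using (All)
open import Relation.Binary.PropositionalEquality using (_≡_; _≢_)
open import Relation.Nullary using (¬_)
open import Function.Bundles using (_⇔_)
open import Algebra.Bundles using (CommutativeRing)

-- Ordered fields (the stdlib has none).  ℝ is a model; we state the
-- theorem for an arbitrary ordered field.

record OrderedField : Set₁ where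
  field
    commutativeRing : CommutativeRing 0ℓ 0ℓ
  open CommutativeRing commutativeRing
  field
    0≉1      : ¬ (0# ≈ 1#)
    inverse  : ∀ x → ¬ (x ≈ 0#) → ∃[ y ] (x * y ≈ 1#)
    _<ᶠ_     : Carrier → Carrier → Set
    <-resp-≈ : ∀ {x x′ y y′} → x ≈ x′ → y ≈ y′ → x <ᶠ y → x′ <ᶠ y′
    <-irrefl : ∀ {x y} → x ≈ y → ¬ (x <ᶠ y)
    <-trans  : ∀ {x y z} → x <ᶠ y → y <ᶠ z → x <ᶠ z
    <-tri    : ∀ x y → (x <ᶠ y) ⊎ (x ≈ y) ⊎ (y <ᶠ x)
    +-mono-< : ∀ {x y} z → x <ᶠ y → (x + z) <ᶠ (y + z)
    *-pos    : ∀ {x y} → 0# <ᶠ x → 0# <ᶠ y → 0# <ᶠ (x * y)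

module _ (F : OrderedField) where
  open OrderedField F
  open CommutativeRing commutativeRing

  _≤ᶠ_ : Carrier → Carrier → Set
  x ≤ᶠ y = (x <ᶠ y) ⊎ (x ≈ y)

  Point : Set
  Point = Carrier × Carrier

  _≈ₚ_ : Point → Point → Set
  (x₁ , y₁) ≈ₚ (x₂ , y₂) = (x₁ ≈ x₂) × (y₁ ≈ y₂)

  AtParam : Carrier → Point → Point → Point → Set
  AtParam t (a₁ , a₂) (b₁ , b₂) x = x ≈ₚ (a₁ + t * (b₁ - a₁) , a₂ + t * (b₂ - a₂))

  InOpenSeg : Point → Point → Point → Set
  InOpenSeg x a b = ∃[ t ] ((0# <ᶠ t) × (t <ᶠ 1#) × AtParam t a b x)

  InClosedSeg : Point → Point → Point → Set
  InClosedSeg x a b = ∃[ t ] ((0# ≤ᶠ t) × (t ≤ᶠ 1#) × AtParam t a b x)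

  Collinear : Point → Point → Point → Set
  Collinear (a₁ , a₂) (b₁ , b₂) (c₁ , c₂) =
    ((b₁ - a₁) * (c₂ - a₂)) ≈ ((b₂ - a₂) * (c₁ - a₁))

  module _ {n : ℕ} (p : Fin n → Point) where

    Distinct : Set
    Distinct = ∀ i j → i ≢ j → ¬ (p i ≈ₚ p j)

    AtMostCollinear : ℕ → Set
    AtMostCollinear ℓ = ∀ (S : List (Fin n)) → Unique S →
      (∀ {i j k} → i ∈ S → j ∈ S → k ∈ S → Collinear (p i) (p j) (p k)) →
      length S ℕ.≤ ℓ

    Visible : Fin n → Fin n → Set
    Visible i j = (i ≢ j) × (∀ k → ¬ InOpenSeg (p k) (p i) (p j))

    IsPath : Fin n → Fin n → List (Fin n) → Set
    IsPath v w us = (head us ≡ just v) × (last us ≡ just w)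
                  × Linked Visible us × Unique us

    -- us consists of the consecutive points of P along the segment vw
    StraightPath : Fin n → Fin n → List (Fin n) → Set
    StraightPath v w us = IsPath v w us
                        × (∀ k → (k ∈ us) ⇔ InClosedSeg (p k) (p v) (p w))

    OneBendPath : Fin n → Fin n → List (Fin n) → Set
    OneBendPath v w us = IsPath v w us ×
      (StraightPath v w us ⊎
       ∃[ x ] ∃[ as ] ∃[ bs ] ((us ≡ as ++ bs) × StraightPath v x as
                                × StraightPath x w (x ∷ bs)))

    Consecutive : Fin n → Fin n → List (Fin n) → Set
    Consecutive a b us = ∃[ xs ] ∃[ ys ] (us ≡ xs ++ a ∷ b ∷ ys)

    UsesEdge : Fin n → Fin n → List (Fin n) → Set
    UsesEdge a b us = Consecutive a b us ⊎ Consecutive b a us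

    EdgeDisjoint : List (Fin n) → List (Fin n) → Set
    EdgeDisjoint us vs = ∀ a b → UsesEdge a b us → ¬ UsesEdge a b vs

    ConnectedWithout : List (Fin n × Fin n) → Set
    ConnectedWithout E = ∀ v w → ∃[ us ] (IsPath v w us ×
      (∀ a b → UsesEdge a b us → ¬ ((a , b) ∈ E)))

    EdgeConnected : ℕ → Set
    EdgeConnected k = ∀ (E : List (Fin n × Fin n)) → length E ℕ.< k →
      ConnectedWithout E

    HasDegree : Fin n → ℕ → Set
    HasDegree v d = ∃[ N ] ((length N ≡ d) × Unique N ×
      (∀ w → (w ∈ N) ⇔ Visible v w))

-- ceiling division ⌈ a / b ⌉ (b > 0; value 0 for b = 0, never used)
⌈_/_⌉ : ℕ → ℕ → ℕ
⌈ a / zero ⌉  = 0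
⌈ a / suc b ⌉ = (a ℕ.+ b) ℕ./ suc b

{-# OPTIONS --safe #-}
-- Lower bound: for points x off the line vw, group the x by the line vx and
-- by the line xw.  This is a bipartite graph with one edge per point x and with
-- maximum degree at most ℓ - 1, so by Kőnig's theorem it has a matching with at
-- least ⌈m / (ℓ - 1)⌉ edges, where m ≥ n - ℓ is the number of points off vw.
-- Bending at the matched points gives paths v x w that pairwise share no line,
-- hence no edge; the straight path from v to w is one more.  Edge-connectivity
-- follows by pigeonhole.
--
-- Sharpness: put ℓ - 1 points on each of d rays from v, otherwise in general
-- position.  Then v sees exactly the first point of each ray.
module Submission where

open import Defs
open import Level using (0ℓ)
open import Data.Nat as ℕ using (ℕ; zero; suc)
import Data.Nat.Properties as ℕ
open import Data.Integer as ℤ using (ℤ; -[1+_]; _⊖_)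
import Data.Integer.Properties as ℤ
open import Data.Maybe using (Maybe; just; nothing)
open import Data.Product using (Σ; ∃; ∃-syntax; _×_; _,_; proj₁; proj₂; swap)
open import Data.Sum as Sum using (_⊎_; inj₁; inj₂; [_,_]′)
open import Algebra.Bundles using (CommutativeRing)
open import Algebra.Solver.Ring.AlmostCommutativeRing using (fromCommutativeRing; _-Raw-AlmostCommutative⟶_)
import Algebra.Solver.Ring
import Algebra.Properties.Ring
import Algebra.Properties.Semiring.Mult.TCOptimised
import Relation.Binary.Reasoning.Setoid
open import Relation.Binary.Definitions using (tri<; tri≈; tri>)
open import Relation.Binary.PropositionalEquality as ≡ using (_≡_; _≢_)
open import Relation.Nullary using (¬_; Dec; yes; no; contradiction; ¬?)
open import Relation.Nullary.Decidable using (map′; _×-dec_; _⊎-dec_; decidable-stable)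

-- Ordered fields and plane geometry

-- Two bends x and y on one line through v can give paths that share the first edge at v; the same
-- happens at w. This is why the bends have to be independent on both sides at once, hence a
-- matching. Conversely, an edge has distinct ends and so determines its line: the paths of
-- independent bends could share an edge only if a line at v coincided with a line at w, and such a
-- line would be vw, which the bends avoid. The count is exact because the points lost on vw are
-- repaid by the straight path: 1 + ⌈(n - ℓ) / (ℓ - 1)⌉ = ⌈(n - 1) / (ℓ - 1)⌉. For sharpness,
-- general position has to hold over every ordered field, so the points are taken from ℕ², with a
-- power of a fixed base as abscissa. The determinant of three points then compares numbers of very
-- different size, and reading it modulo the base forces the slopes to agree.

module IntegerCoefficients (R : CommutativeRing 0ℓ 0ℓ) where
  open import Data.Integer using (+_)
  open CommutativeRing R
  open Algebra.Properties.Ring ring using (-‿distribˡ-*; -‿distribʳ-*; -0#≈0#; -‿involutive; -‿anti-homo-+)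
  open Algebra.Properties.Semiring.Mult.TCOptimised semiring using (×1-homo-*; ×-homo-+; 1+×) renaming (_×_ to _·_)
  open Relation.Binary.Reasoning.Setoid setoid

  fromℕ : ℕ → Carrier
  fromℕ n = n · 1#

  fromℤ : ℤ → Carrier
  fromℤ (+ n)    = fromℕ n
  fromℤ -[1+ n ] = - fromℕ (suc n)

  fromℕ-+ : ∀ m n → fromℕ (m ℕ.+ n) ≈ fromℕ m + fromℕ n
  fromℕ-+ = ×-homo-+ 1#

  fromℕ-* : ∀ m n → fromℕ (m ℕ.* n) ≈ fromℕ m * fromℕ n
  fromℕ-* = ×1-homo-*

  fromℤ-⊖ : ∀ m n → fromℤ (m ⊖ n) ≈ fromℕ m - fromℕ n
  fromℤ-⊖ m       zero    = sym (trans (+-congˡ -0#≈0#) (+-identityʳ _))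
  fromℤ-⊖ zero    (suc n) = sym (+-identityˡ _)
  fromℤ-⊖ (suc m) (suc n) = begin
    fromℤ (suc m ⊖ suc n)                      ≡⟨ ≡.cong fromℤ (ℤ.[1+m]⊖[1+n]≡m⊖n m n) ⟩
    fromℤ (m ⊖ n)                              ≈⟨ fromℤ-⊖ m n ⟩
    fromℕ m - fromℕ n                          ≈⟨ +-congʳ (+-identityʳ _) ⟨
    fromℕ m + 0# - fromℕ n                     ≈⟨ +-congʳ (+-congˡ (-‿inverseʳ 1#)) ⟨
    fromℕ m + (1# - 1#) - fromℕ n              ≈⟨ +-congʳ (+-assoc _ _ _) ⟨
    fromℕ m + 1# - 1# - fromℕ n                ≈⟨ +-assoc _ _ _ ⟩
    fromℕ m + 1# + (- 1# - fromℕ n)            ≈⟨ +-cong (+-comm _ _) (+-comm _ _) ⟩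
    1# + fromℕ m + (- fromℕ n - 1#)            ≈⟨ +-congˡ (-‿anti-homo-+ _ _) ⟨
    1# + fromℕ m - (1# + fromℕ n)              ≈⟨ +-cong (1+× m 1#) (-‿cong (1+× n 1#)) ⟨
    fromℕ (suc m) - fromℕ (suc n)              ∎

  fromℤ-+ : ∀ i j → fromℤ (i ℤ.+ j) ≈ fromℤ i + fromℤ j
  fromℤ-+ (+ m)    (+ n)    = fromℕ-+ m n
  fromℤ-+ (+ m)    -[1+ n ] = fromℤ-⊖ m (suc n)
  fromℤ-+ -[1+ m ] (+ n)    = trans (fromℤ-⊖ n (suc m)) (+-comm _ _)
  fromℤ-+ -[1+ m ] -[1+ n ] = begin
    - fromℕ (suc (suc (m ℕ.+ n)))      ≡⟨ ≡.cong (λ k → - fromℕ k) (≡.cong suc (≡.sym (ℕ.+-suc m n))) ⟩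
    - fromℕ (suc m ℕ.+ suc n)          ≈⟨ -‿cong (fromℕ-+ (suc m) (suc n)) ⟩
    - (fromℕ (suc m) + fromℕ (suc n))  ≈⟨ -‿anti-homo-+ _ _ ⟩
    - fromℕ (suc n) - fromℕ (suc m)    ≈⟨ +-comm _ _ ⟩
    - fromℕ (suc m) - fromℕ (suc n)    ∎

  fromℤ-neg : ∀ i → fromℤ (ℤ.- i) ≈ - fromℤ i
  fromℤ-neg (+ zero)  = sym -0#≈0#
  fromℤ-neg (+ suc n) = refl
  fromℤ-neg -[1+ n ]  = sym (-‿involutive _)

  fromℤ-pos-* : ∀ m j → fromℤ (+ m ℤ.* j) ≈ fromℕ m * fromℤ j
  fromℤ-pos-* m (+ n) = trans (reflexive (≡.cong fromℤ (≡.sym (ℤ.pos-* m n)))) (fromℕ-* m n)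
  fromℤ-pos-* m -[1+ n ] = begin
    fromℤ (+ m ℤ.* -[1+ n ])         ≡⟨ ≡.cong fromℤ (ℤ.neg-distribʳ-* (+ m) (+ suc n)) ⟨
    fromℤ (ℤ.- (+ m ℤ.* + suc n))    ≈⟨ fromℤ-neg (+ m ℤ.* + suc n) ⟩
    - fromℤ (+ m ℤ.* + suc n)        ≈⟨ -‿cong (fromℤ-pos-* m (+ suc n)) ⟩
    - (fromℕ m * fromℕ (suc n))      ≈⟨ -‿distribʳ-* _ _ ⟩
    fromℕ m * - fromℕ (suc n)        ∎

  fromℤ-* : ∀ i j → fromℤ (i ℤ.* j) ≈ fromℤ i * fromℤ j
  fromℤ-* (+ m)    j = fromℤ-pos-* m j
  fromℤ-* -[1+ m ] j = begin
    fromℤ (-[1+ m ] ℤ.* j)           ≡⟨ ≡.cong fromℤ (ℤ.neg-distribˡ-* (+ suc m) j) ⟨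
    fromℤ (ℤ.- (+ suc m ℤ.* j))      ≈⟨ fromℤ-neg (+ suc m ℤ.* j) ⟩
    - fromℤ (+ suc m ℤ.* j)          ≈⟨ -‿cong (fromℤ-pos-* (suc m) j) ⟩
    - (fromℕ (suc m) * fromℤ j)      ≈⟨ -‿distribˡ-* _ _ ⟩
    - fromℕ (suc m) * fromℤ j        ∎

  -- The solver cancels terms by comparing coefficients. Integer coefficients have decidable
  -- equality, whatever the ring.
  morphism : ℤ.+-*-rawRing -Raw-AlmostCommutative⟶ fromCommutativeRing R
  morphism = record
    { ⟦_⟧    = fromℤ
    ; +-homo = fromℤ-+
    ; *-homo = fromℤ-*
    ; -‿homo = fromℤ-neg
    ; 0-homo = refl
    ; 1-homo = refl
    }

  private
    coeff≟ : ∀ i j → Maybe (fromℤ i ≈ fromℤ j)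
    coeff≟ i j with i ℤ.≟ j
    ... | yes i≡j = just (reflexive (≡.cong fromℤ i≡j))
    ... | no  _   = nothing

  open Algebra.Solver.Ring ℤ.+-*-rawRing (fromCommutativeRing R) morphism coeff≟ public
    using (solve; _:=_; _:+_; _:*_; _:-_; :-_; con; Polynomial)

  :0 :1 : ∀ {n} → Polynomial n
  :0 = con (+ 0)
  :1 = con (+ 1)

module OrderedFieldProperties (F : OrderedField) where
  open OrderedField F public
  open CommutativeRing commutativeRing public
  open IntegerCoefficients commutativeRing public
  open Algebra.Properties.Ring ring public using (x∙y⁻¹≈ε⇒x≈y; x≈y⇒x∙y⁻¹≈ε)

  infix 4 _<_ _≤_
  _<_ : Carrier → Carrier → Set
  _<_ = _<ᶠ_

  _≤_ : Carrier → Carrier → Set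
  _≤_ = _≤ᶠ_ F

  -- The next two lemmas derive an equation from a certificate, checked by
  -- the ring solver, that it is a linear combination of known equations.
  linear₁ : ∀ {a b l r} c → a ≈ b → l - r ≈ c * (a - b) → l ≈ r
  linear₁ {a} {b} {l} {r} c a≈b eq = x∙y⁻¹≈ε⇒x≈y l r
    (trans eq (trans (*-congˡ (x≈y⇒x∙y⁻¹≈ε a≈b)) (zeroʳ c)))

  linear₂ : ∀ {a b a′ b′ l r} c c′ → a ≈ b → a′ ≈ b′ →
            l - r ≈ c * (a - b) + c′ * (a′ - b′) → l ≈ r
  linear₂ {a} {b} {a′} {b′} {l} {r} c c′ a≈b a′≈b′ eq = x∙y⁻¹≈ε⇒x≈y l r
    (trans eq (trans (+-cong (trans (*-congˡ (x≈y⇒x∙y⁻¹≈ε a≈b)) (zeroʳ c))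
                             (trans (*-congˡ (x≈y⇒x∙y⁻¹≈ε a′≈b′)) (zeroʳ c′)))
                     (+-identityʳ 0#)))

  -- Trichotomy is the source of decidability: the tests for collinearity and for lying on a
  -- segment, and with them the case splits on points, rest on it.
  _≟_ : ∀ x y → Dec (x ≈ y)
  x ≟ y with <-tri x y
  ... | inj₁ x<y        = no λ x≈y → <-irrefl x≈y x<y
  ... | inj₂ (inj₁ x≈y) = yes x≈y
  ... | inj₂ (inj₂ y<x) = no λ x≈y → <-irrefl (sym x≈y) y<x

  <-asym : ∀ {x y} → x < y → ¬ (y < x)
  <-asym x<y y<x = <-irrefl refl (<-trans x<y y<x)

  _<?_ : ∀ x y → Dec (x < y)
  x <? y with <-tri x y
  ... | inj₁ x<y        = yes x<y
  ... | inj₂ (inj₁ x≈y) = no (<-irrefl x≈y)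
  ... | inj₂ (inj₂ y<x) = no (<-asym y<x)

  ≤-total : ∀ x y → x ≤ y ⊎ y ≤ x
  ≤-total x y with <-tri x y
  ... | inj₁ x<y        = inj₁ (inj₁ x<y)
  ... | inj₂ (inj₁ x≈y) = inj₁ (inj₂ x≈y)
  ... | inj₂ (inj₂ y<x) = inj₂ (inj₁ y<x)

  <-≤-trans : ∀ {x y z} → x < y → y ≤ z → x < z
  <-≤-trans x<y (inj₁ y<z) = <-trans x<y y<z
  <-≤-trans x<y (inj₂ y≈z) = <-resp-≈ refl y≈z x<y

  ≤-trans : ∀ {x y z} → x ≤ y → y ≤ z → x ≤ z
  ≤-trans (inj₁ x<y) y≤z        = inj₁ (<-≤-trans x<y y≤z)
  ≤-trans (inj₂ x≈y) (inj₁ y<z) = inj₁ (<-resp-≈ (sym x≈y) refl y<z)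
  ≤-trans (inj₂ x≈y) (inj₂ y≈z) = inj₂ (trans x≈y y≈z)

  ≤-antisym : ∀ {x y} → x ≤ y → y ≤ x → x ≈ y
  ≤-antisym (inj₂ x≈y) _          = x≈y
  ≤-antisym (inj₁ x<y) (inj₂ y≈x) = sym y≈x
  ≤-antisym (inj₁ x<y) (inj₁ y<x) = contradiction y<x (<-asym x<y)

  ≤-resp-≈ : ∀ {x x′ y y′} → x ≈ x′ → y ≈ y′ → x ≤ y → x′ ≤ y′
  ≤-resp-≈ p q (inj₁ x<y) = inj₁ (<-resp-≈ p q x<y)
  ≤-resp-≈ p q (inj₂ x≈y) = inj₂ (trans (sym p) (trans x≈y q))

  0<y-x : ∀ {x y} → x < y → 0# < y - x
  0<y-x {x} x<y = <-resp-≈ (-‿inverseʳ x) refl (+-mono-< (- x) x<y)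

  0<y-x⇒x<y : ∀ {x y} → 0# < y - x → x < y
  0<y-x⇒x<y {x} {y} 0<y-x = <-resp-≈ (+-identityˡ x)
    (solve 2 (λ x y → y :- x :+ x := y) refl x y) (+-mono-< x 0<y-x)

  1-‿anti-< : ∀ {x y} → x < y → 1# - y < 1# - x
  1-‿anti-< {x} {y} x<y = 0<y-x⇒x<y (<-resp-≈ refl
    (solve 2 (λ x y → y :- x := :1 :- x :- (:1 :- y)) refl x y) (0<y-x x<y))

  1-‿anti-≤ : ∀ {x y} → x ≤ y → 1# - y ≤ 1# - x
  1-‿anti-≤ (inj₁ x<y) = inj₁ (1-‿anti-< x<y)
  1-‿anti-≤ (inj₂ x≈y) = inj₂ (+-congˡ (-‿cong (sym x≈y)))

  1-0≈1 : 1# - 0# ≈ 1#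
  1-0≈1 = solve 0 (:1 :- :0 := :1) refl

  1-[1-x]≈x : ∀ x → 1# - (1# - x) ≈ x
  1-[1-x]≈x = solve 1 (λ x → :1 :- (:1 :- x) := x) refl

  *-monoʳ-< : ∀ {x y z} → 0# < z → x < y → x * z < y * z
  *-monoʳ-< {x} {y} {z} 0<z x<y = 0<y-x⇒x<y (<-resp-≈ refl
    (solve 3 (λ x y z → (y :- x) :* z := y :* z :- x :* z) refl x y z) (*-pos (0<y-x x<y) 0<z))

  *-monoʳ-≤ : ∀ {x y z} → 0# ≤ z → x ≤ y → x * z ≤ y * z
  *-monoʳ-≤ (inj₁ 0<z) (inj₁ x<y) = inj₁ (*-monoʳ-< 0<z x<y)
  *-monoʳ-≤ _          (inj₂ x≈y) = inj₂ (*-congʳ x≈y)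
  *-monoʳ-≤ {x} {y} {z} (inj₂ 0≈z) _ = inj₂ (trans (x*z≈0 x) (sym (x*z≈0 y)))
    where
    x*z≈0 : ∀ x → x * z ≈ 0#
    x*z≈0 x = trans (*-congˡ (sym 0≈z)) (zeroʳ x)

  0<1 : 0# < 1#
  0<1 with <-tri 0# 1#
  ... | inj₁ 0<1        = 0<1
  ... | inj₂ (inj₁ 0≈1) = contradiction 0≈1 0≉1
  ... | inj₂ (inj₂ 1<0) = <-resp-≈ refl
    (solve 0 ((:0 :- :1) :* (:0 :- :1) := :1) refl)
    (*-pos (0<y-x 1<0) (0<y-x 1<0))

  >⇒≉ : ∀ {x} → 0# < x → ¬ (x ≈ 0#)
  >⇒≉ 0<x x≈0 = <-irrefl (sym x≈0) 0<x

  inverse-pos : ∀ {x y} → 0# < x → x * y ≈ 1# → 0# < y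
  inverse-pos {x} {y} 0<x xy≈1 with <-tri 0# y
  ... | inj₁ 0<y        = 0<y
  ... | inj₂ (inj₁ 0≈y) = contradiction (trans (sym (zeroʳ x)) (trans (*-congˡ 0≈y) xy≈1)) 0≉1
  ... | inj₂ (inj₂ y<0) = contradiction
    (<-resp-≈ (trans (*-comm y x) xy≈1) (zeroˡ x) (*-monoʳ-< 0<x y<0)) (<-asym 0<1)

  *-cancelˡ : ∀ {c x y} → ¬ (c ≈ 0#) → c * x ≈ c * y → x ≈ y
  *-cancelˡ {c} {x} {y} c≉0 cx≈cy with c⁻¹ , cc⁻¹≈1 ← inverse c c≉0 =
    linear₂ c⁻¹ (y - x) cx≈cy cc⁻¹≈1
      (solve 4 (λ c x y i → x :- y := i :* (c :* x :- c :* y) :+ (y :- x) :* (c :* i :- :1)) refl c x y c⁻¹)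

  fromℕ-pos : ∀ n → 0# < fromℕ (suc n)
  fromℕ-pos zero    = 0<1
  fromℕ-pos (suc n) = <-trans 0<1
    (<-resp-≈ (+-identityˡ 1#) refl (+-mono-< 1# (fromℕ-pos n)))

  fromℕ-mono-< : ∀ {m n} → m ℕ.< n → fromℕ m < fromℕ n
  fromℕ-mono-< {m} {n} m<n = 0<y-x⇒x<y (<-resp-≈ refl (trans (fromℤ-cong eq) (fromℤ-⊖ n m)) (fromℕ-pos (n ℕ.∸ suc m)))
    where
    fromℤ-cong : ∀ {i j} → i ≡ j → fromℤ i ≈ fromℤ j
    fromℤ-cong ≡.refl = refl
    eq : ℤ.+ suc (n ℕ.∸ suc m) ≡ n ⊖ m
    eq = ≡.trans (≡.cong ℤ.+_ (≡.sym (ℕ.+-∸-assoc 1 m<n))) (≡.sym (ℤ.⊖-≥ (ℕ.<⇒≤ m<n)))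

  -- Ordered fields have characteristic zero. This carries the configuration in ℕ² that shows
  -- sharpness over to every ordered field.
  fromℕ-injective : ∀ {m n} → fromℕ m ≈ fromℕ n → m ≡ n
  fromℕ-injective {m} {n} eq with ℕ.<-cmp m n
  ... | tri< m<n _ _ = contradiction (fromℕ-mono-< m<n) (<-irrefl eq)
  ... | tri≈ _ m≡n _ = m≡n
  ... | tri> _ _ n<m = contradiction (fromℕ-mono-< n<m) (<-irrefl (sym eq))

-- Collinearity and segments over an ordered field

module Geometry (F : OrderedField) where
  open OrderedFieldProperties F

  infix 4 _≈ₚ′_
  _≈ₚ′_ : Point F → Point F → Set
  _≈ₚ′_ = _≈ₚ_ F

  ≈ₚ-refl : ∀ {a} → a ≈ₚ′ a
  ≈ₚ-refl = refl , refl

  ≈ₚ-sym : ∀ {a b} → a ≈ₚ′ b → b ≈ₚ′ a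
  ≈ₚ-sym (e₁ , e₂) = sym e₁ , sym e₂

  ≈ₚ-trans : ∀ {a b c} → a ≈ₚ′ b → b ≈ₚ′ c → a ≈ₚ′ c
  ≈ₚ-trans (e₁ , e₂) (f₁ , f₂) = trans e₁ f₁ , trans e₂ f₂

  -- Collinear F a b c says that the vectors b - a and c - a are parallel.
  Parallel : Point F → Point F → Set
  Parallel (u₁ , u₂) (x₁ , x₂) = u₁ * x₂ ≈ u₂ * x₁

  _-ₚ_ : Point F → Point F → Point F
  (a₁ , a₂) -ₚ (b₁ , b₂) = a₁ - b₁ , a₂ - b₂

  data NonzeroCoordinate (u : Point F) : Set where
    nonzero₁ : ¬ (proj₁ u ≈ 0#) → NonzeroCoordinate u
    nonzero₂ : ¬ (proj₂ u ≈ 0#) → NonzeroCoordinate u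

  nonzeroCoordinate : ∀ {a b} → ¬ (a ≈ₚ′ b) → NonzeroCoordinate (b -ₚ a)
  nonzeroCoordinate {a₁ , a₂} {b₁ , b₂} a≉b with (b₁ - a₁) ≟ 0# | (b₂ - a₂) ≟ 0#
  ... | no  p | _     = nonzero₁ p
  ... | yes _ | no  q = nonzero₂ q
  ... | yes p | yes q = contradiction (sym (x∙y⁻¹≈ε⇒x≈y b₁ a₁ p) , sym (x∙y⁻¹≈ε⇒x≈y b₂ a₂ q)) a≉b

  -- Writing x × y for the determinant, u_i (x × y) = x_i (u × y) - y_i (u × x) for either
  -- coordinate i. Both terms on the right vanish, and a nonzero u_i can be cancelled.
  parallel-trans : ∀ {u x y} → NonzeroCoordinate u → Parallel u x → Parallel u y → Parallel x y
  parallel-trans {u₁ , u₂} {x₁ , x₂} {y₁ , y₂} (nonzero₁ u₁≉0) ux uy = *-cancelˡ u₁≉0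
    (linear₂ x₁ (- y₁) uy ux (solve 6 (λ u₁ u₂ x₁ x₂ y₁ y₂ →
      u₁ :* (x₁ :* y₂) :- u₁ :* (x₂ :* y₁) :=
      x₁ :* (u₁ :* y₂ :- u₂ :* y₁) :+ (:- y₁) :* (u₁ :* x₂ :- u₂ :* x₁)) refl u₁ u₂ x₁ x₂ y₁ y₂))
  parallel-trans {u₁ , u₂} {x₁ , x₂} {y₁ , y₂} (nonzero₂ u₂≉0) ux uy = *-cancelˡ u₂≉0
    (linear₂ x₂ (- y₂) uy ux (solve 6 (λ u₁ u₂ x₁ x₂ y₁ y₂ →
      u₂ :* (x₁ :* y₂) :- u₂ :* (x₂ :* y₁) :=
      x₂ :* (u₁ :* y₂ :- u₂ :* y₁) :+ (:- y₂) :* (u₁ :* x₂ :- u₂ :* x₁)) refl u₁ u₂ x₁ x₂ y₁ y₂))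

  parallel-difference : ∀ {u a x y} → Parallel u (x -ₚ a) → Parallel u (y -ₚ a) → Parallel u (y -ₚ x)
  parallel-difference {u₁ , u₂} {a₁ , a₂} {x₁ , x₂} {y₁ , y₂} ux uy =
    linear₂ 1# (- 1#) uy ux (solve 8 (λ u₁ u₂ a₁ a₂ x₁ x₂ y₁ y₂ →
      u₁ :* (y₂ :- x₂) :- u₂ :* (y₁ :- x₁) :=
      :1 :* (u₁ :* (y₂ :- a₂) :- u₂ :* (y₁ :- a₁)) :+
      (:- :1) :* (u₁ :* (x₂ :- a₂) :- u₂ :* (x₁ :- a₁))) refl u₁ u₂ a₁ a₂ x₁ x₂ y₁ y₂)

  collinear? : ∀ a b c → Dec (Collinear F a b c)
  collinear? a b c = _ ≟ _

  collinear-aba : ∀ a b → Collinear F a b a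
  collinear-aba (a₁ , a₂) (b₁ , b₂) =
    solve 4 (λ a₁ a₂ b₁ b₂ → (b₁ :- a₁) :* (a₂ :- a₂) := (b₂ :- a₂) :* (a₁ :- a₁)) refl a₁ a₂ b₁ b₂

  collinear-abb : ∀ a b → Collinear F a b b
  collinear-abb (a₁ , a₂) (b₁ , b₂) = *-comm _ _

  collinear-swap : ∀ a b c → Collinear F a b c → Collinear F a c b
  collinear-swap a b c abc = trans (*-comm _ _) (trans (sym abc) (*-comm _ _))

  -- The incidence law behind all later line arguments. Each of `x`, `y`, `z` may be `a` or `b`, so
  -- it also serves to change the two points by which a line is given.
  collinear-line : ∀ {a b} x y z → ¬ (a ≈ₚ′ b) →
    Collinear F a b x → Collinear F a b y → Collinear F a b z → Collinear F x y z
  collinear-line {a} {b} x y z a≉b abx aby abz = parallel-trans {b -ₚ a} (nonzeroCoordinate a≉b)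
    (parallel-difference {b -ₚ a} {a} {x} {y} abx aby)
    (parallel-difference {b -ₚ a} {a} {x} {z} abx abz)

  atParam-resp : ∀ {s t a b x} → s ≈ t → AtParam F s a b x → AtParam F t a b x
  atParam-resp s≈t (e₁ , e₂) = trans e₁ (+-congˡ (*-congʳ s≈t)) , trans e₂ (+-congˡ (*-congʳ s≈t))

  atParam-compose : ∀ {s t v w k j} → AtParam F t v w k → AtParam F s v k j → AtParam F (s * t) v w j
  atParam-compose (k₁ , k₂) (j₁ , j₂) = coordinate k₁ j₁ , coordinate k₂ j₂
    where
    coordinate : ∀ {s t v w k j} → k ≈ v + t * (w - v) → j ≈ v + s * (k - v) → j ≈ v + s * t * (w - v)
    coordinate {s} {t} {v} {w} {k} {j} k≈ j≈ = linear₂ 1# s j≈ k≈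
      (solve 6 (λ s t v w k j → j :- (v :+ s :* t :* (w :- v)) :=
        :1 :* (j :- (v :+ s :* (k :- v))) :+ s :* (k :- (v :+ t :* (w :- v)))) refl s t v w k j)

  atParam-reverse : ∀ {t v w k} → AtParam F t v w k → AtParam F (1# - t) w v k
  atParam-reverse (k₁ , k₂) = coordinate k₁ , coordinate k₂
    where
    coordinate : ∀ {t v w k} → k ≈ v + t * (w - v) → k ≈ w + (1# - t) * (v - w)
    coordinate {t} {v} {w} {k} k≈ = trans k≈
      (solve 3 (λ t v w → v :+ t :* (w :- v) := w :+ (:1 :- t) :* (v :- w)) refl t v w)

  atParam-0 : ∀ v w → AtParam F 0# v w v
  atParam-0 (v₁ , v₂) (w₁ , w₂) = coordinate v₁ w₁ , coordinate v₂ w₂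
    where
    coordinate : ∀ v w → v ≈ v + 0# * (w - v)
    coordinate = solve 2 (λ v w → v := v :+ :0 :* (w :- v)) refl

  atParam-1 : ∀ v w → AtParam F 1# v w w
  atParam-1 (v₁ , v₂) (w₁ , w₂) = coordinate v₁ w₁ , coordinate v₂ w₂
    where
    coordinate : ∀ v w → w ≈ v + 1# * (w - v)
    coordinate = solve 2 (λ v w → w := v :+ :1 :* (w :- v)) refl

  atParam-rescale : ∀ {r s t v w k j} → r * t ≈ s → ¬ (t ≈ 0#) →
    AtParam F t v w k → AtParam F s v w j → AtParam F r v k j
  atParam-rescale rt≈s t≉0 (k₁ , k₂) (j₁ , j₂) = coordinate k₁ j₁ , coordinate k₂ j₂
    where
    coordinate : ∀ {v w k j} → k ≈ v + _ * (w - v) → j ≈ v + _ * (w - v) → j ≈ v + _ * (k - v)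
    coordinate k≈ j≈ = trans j≈ (+-congˡ (trans (*-congʳ (sym rt≈s)) (trans (*-assoc _ _ _)
      (*-congˡ (sym (trans (+-congʳ k≈) (solve 2 (λ v d → v :+ d :- v := d) refl _ _)))))))

  -- The candidate `t` is found by division in a nonzero coordinate, whether or not `x` lies on the
  -- line. Membership in a segment is then decided by testing this one value.
  atParam-unique : ∀ {v w} x → ¬ (v ≈ₚ′ w) → ∃[ t ] (∀ s → AtParam F s v w x → s ≈ t)
  atParam-unique {v₁ , v₂} {w₁ , w₂} (x₁ , x₂) v≉w = unique (nonzeroCoordinate v≉w)
    where
    coordinate : ∀ {v w} x → ¬ (w - v ≈ 0#) → ∃[ t ] (∀ s → x ≈ v + s * (w - v) → s ≈ t)
    coordinate {v} {w} x d≉0 with i , di≈1 ← inverse (w - v) d≉0 =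
      (x - v) * i , λ s x≈ → linear₂ (- i) (- s) x≈ di≈1
        (solve 5 (λ v w x i s → s :- (x :- v) :* i :=
          (:- i) :* (x :- (v :+ s :* (w :- v))) :+ (:- s) :* ((w :- v) :* i :- :1)) refl v w x i s)

    unique : NonzeroCoordinate ((w₁ , w₂) -ₚ (v₁ , v₂)) → _
    unique (nonzero₁ d≉0) = proj₁ (coordinate x₁ d≉0) , λ s (e , _) → proj₂ (coordinate x₁ d≉0) s e
    unique (nonzero₂ d≉0) = proj₁ (coordinate x₂ d≉0) , λ s (_ , e) → proj₂ (coordinate x₂ d≉0) s e

  param-injective : ∀ {s t v w x} → ¬ (v ≈ₚ′ w) → AtParam F s v w x → AtParam F t v w x → s ≈ t
  param-injective {x = x} v≉w sx tx with t₀ , unique ← atParam-unique x v≉w =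
    trans (unique _ sx) (sym (unique _ tx))

  inOpenSeg? : ∀ {v w} x → ¬ (v ≈ₚ′ w) → Dec (InOpenSeg F x v w)
  inOpenSeg? {v} {w} x v≉w with t , unique ← atParam-unique x v≉w =
    map′ (λ p → t , p)
         (λ (s , 0<s , s<1 , sx) → <-resp-≈ refl (unique s sx) 0<s , <-resp-≈ (unique s sx) refl s<1 ,
                                   atParam-resp (unique s sx) sx)
         ((0# <? t) ×-dec (t <? 1#) ×-dec (_ ≟ _) ×-dec (_ ≟ _))

  open-reverse : ∀ {x v w} → InOpenSeg F x v w → InOpenSeg F x w v
  open-reverse (t , 0<t , t<1 , tx) =
    1# - t , 0<y-x t<1 , <-resp-≈ refl 1-0≈1 (1-‿anti-< 0<t) , atParam-reverse tx

  closed-reverse : ∀ {x v w} → InClosedSeg F x v w → InClosedSeg F x w v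
  closed-reverse (t , 0≤t , t≤1 , tx) =
    1# - t , ≤-resp-≈ (-‿inverseʳ 1#) refl (1-‿anti-≤ t≤1) , ≤-resp-≈ refl 1-0≈1 (1-‿anti-≤ 0≤t) ,
    atParam-reverse tx

  open-shrinkʳ : ∀ {v w k j} → InOpenSeg F k v w → InOpenSeg F j v k → InOpenSeg F j v w
  open-shrinkʳ (t , 0<t , t<1 , tk) (s , 0<s , s<1 , sj) =
    s * t , *-pos 0<s 0<t , <-trans (<-resp-≈ refl (*-identityˡ t) (*-monoʳ-< 0<t s<1)) t<1 ,
    atParam-compose tk sj

  open-shrinkˡ : ∀ {v w k j} → InOpenSeg F k v w → InOpenSeg F j k w → InOpenSeg F j v w
  open-shrinkˡ k∈vw j∈kw = open-reverse (open-shrinkʳ (open-reverse k∈vw) (open-reverse j∈kw))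

  closed-shrinkʳ : ∀ {v w k j} → InOpenSeg F k v w → InClosedSeg F j v k → InClosedSeg F j v w
  closed-shrinkʳ (t , 0<t , t<1 , tk) (s , 0≤s , s≤1 , sj) =
    s * t , ≤-resp-≈ (zeroˡ t) refl (*-monoʳ-≤ (inj₁ 0<t) 0≤s) ,
    ≤-trans (≤-resp-≈ refl (*-identityˡ t) (*-monoʳ-≤ (inj₁ 0<t) s≤1)) (inj₁ t<1) ,
    atParam-compose tk sj

  closed-shrinkˡ : ∀ {v w k j} → InOpenSeg F k v w → InClosedSeg F j k w → InClosedSeg F j v w
  closed-shrinkˡ k∈vw j∈kw = closed-reverse (closed-shrinkʳ (open-reverse k∈vw) (closed-reverse j∈kw))

  closed-restrict : ∀ {s t v w k j} → 0# < t → AtParam F t v w k → 0# ≤ s → s ≤ t → AtParam F s v w j →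
                    InClosedSeg F j v k
  closed-restrict {s} {t} 0<t tk 0≤s s≤t sj with i , ti≈1 ← inverse t (>⇒≉ 0<t) =
    s * i , ≤-resp-≈ (zeroˡ i) refl (*-monoʳ-≤ 0≤i 0≤s) , ≤-resp-≈ refl ti≈1 (*-monoʳ-≤ 0≤i s≤t) ,
    atParam-rescale (trans (*-assoc s i t) (trans (*-congˡ (trans (*-comm i t) ti≈1)) (*-identityʳ s)))
                    (>⇒≉ 0<t) tk sj
    where
    0≤i : 0# ≤ i
    0≤i = inj₁ (inverse-pos 0<t ti≈1)

  closed-split : ∀ {v w k j} → InOpenSeg F k v w → InClosedSeg F j v w →
                 InClosedSeg F j v k ⊎ InClosedSeg F j k w
  closed-split (t , 0<t , t<1 , tk) (s , 0≤s , s≤1 , sj) with ≤-total s t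
  ... | inj₁ s≤t = inj₁ (closed-restrict 0<t tk 0≤s s≤t sj)
  ... | inj₂ t≤s = inj₂ (closed-reverse (closed-restrict (0<y-x t<1) (atParam-reverse tk)
    (≤-resp-≈ (-‿inverseʳ 1#) refl (1-‿anti-≤ s≤1)) (1-‿anti-≤ t≤s) (atParam-reverse sj)))

  -- Measured along `v w`, the parameter of `j` is at most that of `k` by the first membership and
  -- at least that of `k` by the second. The second bound is computed from `w`, and uniqueness of
  -- parameters (`st≈`) identifies the two measurements.
  closed-meet : ∀ {v w k j} → ¬ (v ≈ₚ′ w) → InOpenSeg F k v w →
                InClosedSeg F j v k → InClosedSeg F j k w → j ≈ₚ′ k
  closed-meet v≉w (t , 0<t , t<1 , tk) (s , 0≤s , s≤1 , sj) j∈kw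
    with r , 0≤r , r≤1 , rj ← closed-reverse j∈kw =
    ≈ₚ-trans (atParam-resp (≤-antisym st≤t t≤st) stj) (≈ₚ-sym tk)
    where
    stj   = atParam-compose tk sj
    st≤t  = ≤-resp-≈ refl (*-identityˡ t) (*-monoʳ-≤ (inj₁ 0<t) s≤1)
    st≈   = param-injective v≉w stj (atParam-reverse (atParam-compose (atParam-reverse tk) rj))
    t≤st  = ≤-resp-≈ (1-[1-x]≈x t) (sym st≈)
      (1-‿anti-≤ (≤-resp-≈ refl (*-identityˡ (1# - t)) (*-monoʳ-≤ (inj₁ (0<y-x t<1)) r≤1)))

  closed-cases : ∀ {v w j} → InClosedSeg F j v w → j ≈ₚ′ v ⊎ j ≈ₚ′ w ⊎ InOpenSeg F j v w
  closed-cases {v} {w} (t , inj₂ 0≈t , _ , tj) =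
    inj₁ (≈ₚ-trans (atParam-resp (sym 0≈t) tj) (≈ₚ-sym (atParam-0 v w)))
  closed-cases {v} {w} (t , inj₁ 0<t , inj₂ t≈1 , tj) =
    inj₂ (inj₁ (≈ₚ-trans (atParam-resp t≈1 tj) (≈ₚ-sym (atParam-1 v w))))
  closed-cases (t , inj₁ 0<t , inj₁ t<1 , tj) = inj₂ (inj₂ (t , 0<t , t<1 , tj))

  closed-start : ∀ v w → InClosedSeg F v v w
  closed-start v w = 0# , inj₂ refl , inj₁ 0<1 , atParam-0 v w

  closed-end : ∀ v w → InClosedSeg F w v w
  closed-end v w = 1# , inj₁ 0<1 , inj₂ refl , atParam-1 v w

  open≉start : ∀ {v w k} → ¬ (v ≈ₚ′ w) → InOpenSeg F k v w → ¬ (k ≈ₚ′ v)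
  open≉start {v} {w} v≉w (t , 0<t , _ , tk) k≈v =
    >⇒≉ 0<t (param-injective v≉w (≈ₚ-trans (≈ₚ-sym k≈v) tk) (atParam-0 v w))

  open≉end : ∀ {v w k} → ¬ (v ≈ₚ′ w) → InOpenSeg F k v w → ¬ (k ≈ₚ′ w)
  open≉end v≉w k∈vw k≈w = open≉start (λ w≈v → v≉w (≈ₚ-sym w≈v)) (open-reverse k∈vw) k≈w

  closed⇒collinear : ∀ {v w x} → InClosedSeg F x v w → Collinear F v w x
  closed⇒collinear {v₁ , v₂} {w₁ , w₂} {x₁ , x₂} (t , _ , _ , x₁≈ , x₂≈) =
    linear₂ (w₁ - v₁) (- (w₂ - v₂)) x₂≈ x₁≈ (solve 7 (λ v₁ v₂ w₁ w₂ x₁ x₂ t →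
      (w₁ :- v₁) :* (x₂ :- v₂) :- (w₂ :- v₂) :* (x₁ :- v₁) :=
      (w₁ :- v₁) :* (x₂ :- (v₂ :+ t :* (w₂ :- v₂))) :+
      (:- (w₂ :- v₂)) :* (x₁ :- (v₁ :+ t :* (w₁ :- v₁)))) refl v₁ v₂ w₁ w₂ x₁ x₂ t)

-- Kőnig's theorem

open import Data.Nat using (_+_; _*_; _∸_; _^_; _≤_; _<_; s≤s; z≤n; NonZero)
open import Data.Nat.Properties
open import Data.Nat.DivMod using (_%_; [m+kn]%n≡m%n; m<n⇒m%n≡m; m<n*o⇒m/o<n)
open import Data.Nat.Tactic.RingSolver using (solve-∀)
open import Data.Fin as Fin using (Fin; zero; suc; toℕ; combine; remQuot; inject≤)
import Data.Fin.Properties as Fin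
open import Data.Maybe.Relation.Binary.Connected using (Connected)
open import Data.List using (List; []; _∷_; _++_; length; lookup; head; last; map; filter; allFin)
open import Data.List.Properties using (length-++; length-map; length-tabulate; ++-identityʳ; ∷-injectiveʳ)
open import Data.List.Membership.Propositional using (_∈_)
open import Data.List.Membership.Propositional.Properties
  using (∈-++⁺ˡ; ∈-++⁺ʳ; ∈-++⁻; ∈-map⁺; ∈-map⁻; ∈-filter⁻; ∈-lookup; ∈-allFin; ∈-insert)
open import Data.List.Relation.Unary.Any as Any using (Any; here; there)
import Data.List.Relation.Unary.Any.Properties as Any
open import Data.List.Relation.Unary.All as All using (All; []; _∷_)
import Data.List.Relation.Unary.All.Properties as All
open import Data.List.Relation.Unary.AllPairs as AllPairs using (AllPairs; []; _∷_)
import Data.List.Relation.Unary.AllPairs.Properties as AllPairs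
open import Data.List.Relation.Unary.Linked as Linked using (Linked; [-]; _∷_)
import Data.List.Relation.Unary.Linked.Properties as Linked
open import Data.List.Relation.Unary.Unique.Propositional using (Unique)
import Data.List.Relation.Unary.Unique.Propositional.Properties as Unique
open import Data.List.Relation.Binary.Permutation.Propositional using (_↭_; ↭-refl; ↭-sym; ↭-trans; prep)
  renaming (swap to ↭-swap)
open import Data.List.Relation.Binary.Permutation.Propositional.Properties using (All-resp-↭; ∈-resp-↭; ↭-length)
import Data.List.Relation.Binary.Sublist.Propositional.Properties as Sublist
open Sublist using (filter-⊆; length-mono-≤)
open import Function.Bundles using (mk⇔; Equivalence)
open Equivalence using (to; from)
open import Relation.Binary.Core using (Rel)
open import Relation.Binary.Structures using (IsDecEquivalence)
open ≡ using (refl; cong; cong₂; sym; trans; subst)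
open import Relation.Unary using (Pred; Decidable)

length-filter-split : ∀ {A : Set} {P : Pred A 0ℓ} (P? : Decidable P) xs →
  length (filter P? xs) + length (filter (λ x → ¬? (P? x)) xs) ≡ length xs
length-filter-split P? [] = refl
length-filter-split P? (x ∷ xs) with P? x
... | yes _ = cong suc (length-filter-split P? xs)
... | no  _ = trans (+-suc _ _) (cong suc (length-filter-split P? xs))

-- The elements of E are the edges of a bipartite multigraph whose two sides
-- are the classes of R and the classes of S.
module _ {E : Set} where

  Independent : Rel E 0ℓ → Rel E 0ℓ → Rel E 0ℓ
  Independent R S x y = ¬ R x y × ¬ S x y

  -- Vertices are classes and have no names, so a vertex cover is given by edges standing for their
  -- endpoints: those in `A` for their `R`-class, those in `B` for their `S`-class.
  Covers : Rel E 0ℓ → Rel E 0ℓ → List E → List E → Pred E 0ℓ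
  Covers R S A B e = Any (R e) A ⊎ Any (S e) B

  -- The theorem as a certificate: the cover will bound the number of edges, and `small` passes this
  -- bound on to the matching.
  record MatchingAndCover (R S : Rel E 0ℓ) (es : List E) : Set where
    constructor mkMC
    field
      matching    : List E
      coverR      : List E
      coverS      : List E
      matching⊆   : All (_∈ es) matching
      independent : AllPairs (Independent R S) matching
      covers      : All (Covers R S coverR coverS) es
      small       : length coverR + length coverS ≤ length matching

  MatchingAndCover-swap : ∀ {R S es} → MatchingAndCover R S es → MatchingAndCover S R es
  MatchingAndCover-swap (mkMC M A B M⊆ ind cov small) =
    mkMC M B A M⊆ (AllPairs.map swap ind) (All.map Sum.swap cov)
         (≤-trans (≤-reflexive (+-comm (length B) (length A))) small)

  MatchingAndCover-resp-↭ : ∀ {R S es es′} → es ↭ es′ → MatchingAndCover R S es → MatchingAndCover R S es′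
  MatchingAndCover-resp-↭ p (mkMC M A B M⊆ ind cov small) =
    mkMC M A B (All.map (∈-resp-↭ p) M⊆) ind (All-resp-↭ p cov) small

  module ClassUnion {R : Rel E 0ℓ} (isDecEquiv : IsDecEquivalence R) (A A′ : List E) where
    open IsDecEquivalence isDecEquiv renaming (_≟_ to R?; sym to R-sym; trans to R-trans)

    covered? : Decidable (λ e → Any (R e) A)
    covered? e = Any.any? (R? e) A

    -- These are operations on sets of classes, so elements of `A′` are sorted by whether `A`
    -- represents their class. Splitting the list `A′` in two keeps |A ∪ A′| + |A ∩ A′| = |A| + |A′|
    -- exact even when a class is listed repeatedly.
    union intersection : List E
    union        = A ++ filter (λ e → ¬? (covered? e)) A′
    intersection = filter covered? A′

    length-union-intersection : length union + length intersection ≡ length A + length A′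
    length-union-intersection = begin
      length union + length intersection                  ≡⟨ cong (_+ length intersection) (length-++ A) ⟩
      length A + length A′∖A + length intersection        ≡⟨ +-assoc (length A) (length A′∖A) _ ⟩
      length A + (length A′∖A + length intersection)
        ≡⟨ cong (length A +_) (+-comm (length A′∖A) (length intersection)) ⟩
      length A + (length intersection + length A′∖A)      ≡⟨ cong (length A +_) (length-filter-split covered? A′) ⟩
      length A + length A′                                ∎
      where
      open ≡.≡-Reasoning
      A′∖A = filter (λ e → ¬? (covered? e)) A′

    ∈-intersection : ∀ {e} → Any (R e) A → Any (R e) A′ → Any (R e) intersection
    ∈-intersection eA eA′ with Any.filter⁺ covered? eA′
    ... | inj₁ e∈ = e∈
    ... | inj₂ ¬c = contradiction eA λ _ → ¬covered (Any.lookup-result eA′)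
      where
      ¬covered : ¬ R _ (Any.lookup eA′)
      ¬covered Ree′ = ¬c (Any.map (R-trans (R-sym Ree′)) eA)

    ∈-unionˡ : ∀ {e} → Any (R e) A → Any (R e) union
    ∈-unionˡ = Any.++⁺ˡ

    ∈-unionʳ : ∀ {e} → Any (R e) A′ → Any (R e) union
    ∈-unionʳ {e} eA′ with Any.filter⁺ (λ e → ¬? (covered? e)) eA′
    ... | inj₁ e∈ = Any.++⁺ʳ A e∈
    ... | inj₂ ¬¬c with covered? (Any.lookup eA′)
    ...   | yes c = Any.++⁺ˡ (Any.map (R-trans (Any.lookup-result eA′)) c)
    ...   | no ¬c = contradiction ¬c ¬¬c

  -- If both d > m and d′ > m′, the sum exceeds m + m′ by at least 2. The slack of 1 pays for the
  -- one vertex that `uncross` adds to a cover.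
  choose-larger : ∀ {m m′ d d′ : ℕ} → d + d′ ≤ suc (m + m′) → (d ≤ m ⊎ d′ ≤ m) ⊎ (d ≤ m′ ⊎ d′ ≤ m′)
  choose-larger {m} {m′} {d} {d′} d+d′≤ with d ≤? m | d′ ≤? m′
  ... | yes d≤m | _ = inj₁ (inj₁ d≤m)
  ... | _ | yes d′≤m′ = inj₂ (inj₂ d′≤m′)
  ... | no d≰m | no d′≰m′ = contradiction
    (≤-trans (≤-reflexive (cong suc (sym (+-suc m m′)))) (+-mono-≤ (≰⇒> d≰m) (≰⇒> d′≰m′))) (≤⇒≯ d+d′≤)

  module _ {R S : Rel E 0ℓ} (R-isDecEquiv : IsDecEquivalence R) (S-isDecEquiv : IsDecEquivalence S) where
    private
      module R = IsDecEquivalence R-isDecEquiv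
      module S = IsDecEquivalence S-isDecEquiv

    -- Lovász's uncrossing: if the cover without e misses e and the cover
    -- without e′ misses e′, then union and intersection (taken oppositely on
    -- the two sides) give two covers of all edges, one of them small enough.
    uncross : ∀ {e e′ r} → R e e′ → MatchingAndCover R S (e′ ∷ r) → MatchingAndCover R S (e ∷ r) →
              MatchingAndCover R S (e ∷ e′ ∷ r)
    uncross {e} {e′} {r} Ree′ (mkMC M A B M⊆ ind (cov-e′ ∷ cov) small) (mkMC M′ A′ B′ M′⊆ ind′ (cov′-e ∷ cov′) small′)
      with Any.any? (R._≟_ e) A ⊎-dec Any.any? (S._≟_ e) B
         | Any.any? (R._≟_ e′) A′ ⊎-dec Any.any? (S._≟_ e′) B′
    ... | yes cov-e | _ = mkMC M A B (All.map there M⊆) ind (cov-e ∷ cov-e′ ∷ cov) small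
    ... | no _ | yes cov′-e′ =
      mkMC M′ A′ B′ (All.map (λ { (here p) → here p ; (there q) → there (there q) }) M′⊆) ind′
           (cov′-e ∷ cov′-e′ ∷ cov′) small′
    ... | no ¬cov-e | no ¬cov′-e′ = choose (choose-larger sizes)
      where
      module A = ClassUnion R-isDecEquiv A A′
      module B = ClassUnion S-isDecEquiv B B′
      M⊆′ : All (_∈ e ∷ e′ ∷ r) M
      M⊆′ = All.map there M⊆
      M′⊆′ : All (_∈ e ∷ e′ ∷ r) M′
      M′⊆′ = All.map (λ { (here p) → here p ; (there q) → there (there q) }) M′⊆

      -- `e` and `e′` share their `R`-vertex, so covering `e′` there would cover `e` too; the first
      -- cover must reach `e′` on the `S` side. Symmetrically for `e` in the second cover.
      e′∈B : Any (S e′) B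
      e′∈B = [ (λ e′∈A → contradiction (inj₁ (Any.map (R.trans Ree′) e′∈A)) ¬cov-e) , (λ x → x) ]′ cov-e′
      e∈B′ : Any (S e) B′
      e∈B′ = [ (λ e∈A′ → contradiction (inj₁ (Any.map (R.trans (R.sym Ree′)) e∈A′)) ¬cov′-e′) , (λ x → x) ]′ cov′-e

      cover₁ : All (Covers R S A.intersection B.union) (e ∷ e′ ∷ r)
      cover₁ = inj₂ (B.∈-unionʳ e∈B′) ∷ inj₂ (B.∈-unionˡ e′∈B) ∷ All.zipWith both (cov , cov′)
        where
        both : ∀ {x} → Covers R S A B x × Covers R S A′ B′ x → Covers R S A.intersection B.union x
        both (inj₁ a , inj₁ a′) = inj₁ (A.∈-intersection a a′)
        both (inj₂ b , _)       = inj₂ (B.∈-unionˡ b)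
        both (inj₁ _ , inj₂ b′) = inj₂ (B.∈-unionʳ b′)

      -- The intersection on the `S` side may lose `e` and `e′`. Their common `R`-vertex,
      -- represented by `e`, covers both, at the cost of 1.
      cover₂ : All (Covers R S (e ∷ A.union) B.intersection) (e ∷ e′ ∷ r)
      cover₂ = inj₁ (here R.refl) ∷ inj₁ (here (R.sym Ree′)) ∷ All.zipWith both (cov , cov′)
        where
        both : ∀ {x} → Covers R S A B x × Covers R S A′ B′ x → Covers R S (e ∷ A.union) B.intersection x
        both (inj₂ b , inj₂ b′) = inj₂ (B.∈-intersection b b′)
        both (inj₁ a , _)       = inj₁ (there (A.∈-unionˡ a))
        both (inj₂ _ , inj₁ a′) = inj₁ (there (A.∈-unionʳ a′))

      sizes : (length A.intersection + length B.union) + (length (e ∷ A.union) + length B.intersection)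
              ≤ suc (length M + length M′)
      sizes = begin
        (length A.intersection + length B.union) + suc (length A.union + length B.intersection)
          ≡⟨ rearrange (length A.intersection) (length B.union) (length A.union) (length B.intersection) ⟩
        suc ((length A.union + length A.intersection) + (length B.union + length B.intersection))
          ≡⟨ ≡.cong₂ (λ x y → suc (x + y)) A.length-union-intersection B.length-union-intersection ⟩
        suc ((length A + length A′) + (length B + length B′))
          ≡⟨ rearrange′ (length A) (length A′) (length B) (length B′) ⟩
        suc ((length A + length B) + (length A′ + length B′))
          ≤⟨ s≤s (+-mono-≤ small small′) ⟩
        suc (length M + length M′) ∎
        where
        open ≤-Reasoning
        rearrange : ∀ a b c d → (a + b) + (1 + (c + d)) ≡ 1 + ((c + a) + (b + d))
        rearrange = solve-∀
        rearrange′ : ∀ a b c d → 1 + ((a + b) + (c + d)) ≡ 1 + ((a + c) + (b + d))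
        rearrange′ = solve-∀

      choose : _ → MatchingAndCover R S (e ∷ e′ ∷ r)
      choose (inj₁ (inj₁ d≤m))   = mkMC M  _ _ M⊆′  ind  cover₁ d≤m
      choose (inj₁ (inj₂ d′≤m))  = mkMC M  _ _ M⊆′  ind  cover₂ d′≤m
      choose (inj₂ (inj₁ d≤m′))  = mkMC M′ _ _ M′⊆′ ind′ cover₁ d≤m′
      choose (inj₂ (inj₂ d′≤m′)) = mkMC M′ _ _ M′⊆′ ind′ cover₂ d′≤m′

    Clash : List E → Set
    Clash es = ∃[ e ] ∃[ e′ ] ∃[ r ] (es ↭ e ∷ e′ ∷ r × (R e e′ ⊎ S e e′))

    clash? : ∀ es → AllPairs (Independent R S) es ⊎ Clash es
    clash? [] = inj₁ []
    clash? (x ∷ xs) with clash? xs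
    ... | inj₂ (e , e′ , r , p , c) = inj₂ (e , e′ , x ∷ r ,
      ↭-trans (prep x p) (↭-trans (↭-swap x e ↭-refl) (prep e (↭-swap x e′ ↭-refl))) , c)
    ... | inj₁ ind with Any.any? (λ y → R._≟_ x y ⊎-dec S._≟_ x y) xs
    ...   | no ¬clash = inj₁
      (All.map (λ ¬RS → (λ Rxy → ¬RS (inj₁ Rxy)) , λ Sxy → ¬RS (inj₂ Sxy)) (All.¬Any⇒All¬ xs ¬clash) ∷ ind)
    ...   | yes clash = inj₂ (x , Any.lookup clash , _ , prep x (remove clash) , Any.lookup-result clash)
      where
      remove : ∀ {P : Pred E 0ℓ} {ys} (i : Any P ys) → ys ↭ Any.lookup i ∷ (ys Any.─ i)
      remove (here _)  = ↭-refl
      remove (there i) = ↭-trans (prep _ (remove i)) (↭-swap _ _ ↭-refl)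

  -- Induction on the number of edges: if two edges meet at a vertex, delete one or the other and
  -- uncross the two certificates. The bound `n` carries the recursion, because the shorter lists
  -- arise only after a permutation.
  matchingAndCover : ∀ {R S : Rel E 0ℓ} → IsDecEquivalence R → IsDecEquivalence S → ∀ es → MatchingAndCover R S es
  matchingAndCover {R} {S} R-isDecEquiv S-isDecEquiv es = go (length es) es ≤-refl
    where
    go : ∀ n es → length es ≤ n → MatchingAndCover R S es
    go n es len with clash? R-isDecEquiv S-isDecEquiv es
    -- No two edges meet, so all of them form the matching, and their `R`-vertices form a cover of
    -- the same size.
    ... | inj₁ ind = mkMC es es [] (All.tabulate (λ x → x)) ind
      (All.tabulate (λ x∈ → inj₁ (Any.map (λ { refl → IsDecEquivalence.refl R-isDecEquiv }) x∈)))
      (≤-reflexive (+-identityʳ _))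
    go n es len | inj₂ (e , e′ , r , p , c) with n | ≤-trans (≤-reflexive (sym (↭-length p))) len
    ... | suc m | s≤s len′ = MatchingAndCover-resp-↭ (↭-sym p) (resolve c)
      where
      without-e  = go m (e′ ∷ r) len′
      without-e′ = go m (e ∷ r) len′
      resolve : R e e′ ⊎ S e e′ → MatchingAndCover R S (e ∷ e′ ∷ r)
      resolve (inj₁ Ree′) = uncross R-isDecEquiv S-isDecEquiv Ree′ without-e without-e′
      resolve (inj₂ See′) = MatchingAndCover-swap (uncross S-isDecEquiv R-isDecEquiv See′
        (MatchingAndCover-swap without-e) (MatchingAndCover-swap without-e′))

  -- Large matchings from a degree bound

  length-filter-filter : ∀ {P Q : Pred E 0ℓ} (P? : Decidable P) (Q? : Decidable Q) xs →
    length (filter P? (filter Q? xs)) ≤ length (filter P? xs)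
  length-filter-filter P? Q? xs = length-mono-≤ (Sublist.filter⁺ P? P? (λ { refl p → p }) (filter-⊆ Q? xs))

  BoundedDegree : {R : Rel E 0ℓ} → (∀ x y → Dec (R x y)) → ℕ → List E → Set
  BoundedDegree R? Δ es = ∀ c → length (filter (λ e → R? e c) es) ≤ Δ

  BoundedDegree-filter : ∀ {R : Rel E 0ℓ} (R? : ∀ x y → Dec (R x y)) {Δ} es {P : Pred E 0ℓ} (P? : Decidable P) →
    BoundedDegree R? Δ es → BoundedDegree R? Δ (filter P? es)
  BoundedDegree-filter R? es P? deg c = ≤-trans (length-filter-filter (λ e → R? e c) P? es) (deg c)

  length≤classes*Δ : ∀ {R : Rel E 0ℓ} (R? : ∀ x y → Dec (R x y)) Δ A es → BoundedDegree R? Δ es →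
    All (λ e → Any (R e) A) es → length es ≤ length A * Δ
  length≤classes*Δ R? Δ []      []      deg cov = z≤n
  length≤classes*Δ R? Δ []      (_ ∷ _) deg (() ∷ _)
  length≤classes*Δ R? Δ (a ∷ A) es      deg cov = begin
    length es                                            ≡⟨ length-filter-split (λ e → R? e a) es ⟨
    length (filter (λ e → R? e a) es) + length others    ≤⟨ +-mono-≤ (deg a) (length≤classes*Δ R? Δ A others
      (BoundedDegree-filter R? es ¬a? deg)
      (All.zipWith (λ (¬a , c) → Any.tail ¬a c) (All.all-filter ¬a? es , All.filter⁺ ¬a? cov))) ⟩
    Δ + length A * Δ                                     ∎
    where
    open ≤-Reasoning
    ¬a? = λ e → ¬? (R? e a)
    others = filter ¬a? es

  length≤cover*Δ : ∀ {R S : Rel E 0ℓ} (R? : ∀ x y → Dec (R x y)) (S? : ∀ x y → Dec (S x y)) Δ A B es →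
    BoundedDegree R? Δ es → BoundedDegree S? Δ es →
    All (Covers R S A B) es → length es ≤ (length A + length B) * Δ
  length≤cover*Δ R? S? Δ A B es degR degS cov = begin
    length es                                                       ≡⟨ length-filter-split inA? es ⟨
    length (filter inA? es) + length (filter ¬inA? es)              ≤⟨ +-mono-≤
      (length≤classes*Δ R? Δ A _ (BoundedDegree-filter R? es inA? degR) (All.all-filter inA? es))
      (length≤classes*Δ S? Δ B _ (BoundedDegree-filter S? es ¬inA? degS)
        (All.zipWith (λ (¬a , c) → [ (λ a → contradiction a ¬a) , (λ b → b) ]′ c)
                     (All.all-filter ¬inA? es , All.filter⁺ ¬inA? cov))) ⟩
    length A * Δ + length B * Δ                                     ≡⟨ *-distribʳ-+ Δ (length A) (length B) ⟨
    (length A + length B) * Δ                                       ∎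
    where
    open ≤-Reasoning
    inA? = λ e → Any.any? (R? e) A
    ¬inA? = λ e → ¬? (inA? e)

  -- Each vertex of the cover accounts for at most `Δ` edges, so the cover has at least |es| / Δ
  -- vertices, and the matching is no smaller.
  largeMatching : ∀ {R S : Rel E 0ℓ} (isR : IsDecEquivalence R) (isS : IsDecEquivalence S) Δ es →
    BoundedDegree (IsDecEquivalence._≟_ isR) Δ es → BoundedDegree (IsDecEquivalence._≟_ isS) Δ es →
    ∃[ M ] (All (_∈ es) M × AllPairs (Independent R S) M × length es ≤ length M * Δ)
  largeMatching isR isS Δ es degR degS with matchingAndCover isR isS es
  ... | mkMC M A B M⊆ ind cov small = M , M⊆ , ind ,
    ≤-trans (length≤cover*Δ (IsDecEquivalence._≟_ isR) (IsDecEquivalence._≟_ isS) Δ A B es degR degS cov)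
            (*-monoˡ-≤ Δ small)

-- Paths in visibility graphs

last-++-∷ : ∀ {A : Set} (xs : List A) y ys → last (xs ++ y ∷ ys) ≡ last (y ∷ ys)
last-++-∷ []            y ys = refl
last-++-∷ (x ∷ [])      y ys = refl
last-++-∷ (x ∷ x′ ∷ xs) y ys = last-++-∷ (x′ ∷ xs) y ys

module VisibilityGraph (F : OrderedField) {n : ℕ} (p : Fin n → Point F) (distinct : Distinct F p) where
  open Geometry F

  p-injective : ∀ {i j} → p i ≈ₚ′ p j → i ≡ j
  p-injective {i} {j} pi≈pj = decidable-stable (i Fin.≟ j) (λ i≢j → distinct i j i≢j pi≈pj)

  col : Fin n → Fin n → Fin n → Set
  col i j k = Collinear F (p i) (p j) (p k)

  col-line : ∀ {a b} x y z → a ≢ b → col a b x → col a b y → col a b z → col x y z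
  col-line x y z a≢b = collinear-line (p x) (p y) (p z) (distinct _ _ a≢b)

  -- The tail `bs` leaves out `k`, which already ends `as`; this is the gluing format of
  -- `OneBendPath`. The last hypothesis rules out repeated vertices.
  isPath-++ : ∀ {v k w as bs} → IsPath F p v k as → IsPath F p k w (k ∷ bs) →
              (∀ j → j ∈ as → j ∈ k ∷ bs → j ≡ k) → IsPath F p v w (as ++ bs)
  isPath-++ {as = a ∷ as} {bs} (head≡ , last≡ , linked , unique) (_ , last′≡ , linked′ , k∉bs ∷ unique′) meet =
    head≡ , last-++ bs last′≡ ,
    Linked.++⁺ linked (subst (λ x → Connected (Visible F p) x (head bs)) (sym last≡) (Linked.head′ linked′))
               (Linked.tail linked′) ,
    Unique.++⁺ unique unique′ (λ (j∈as , j∈bs) → Unique.Unique[x∷xs]⇒x∉xs (k∉bs ∷ unique′)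
      (subst (_∈ bs) (meet _ j∈as (there j∈bs)) j∈bs))
    where
    last-++ : ∀ bs → last (_ ∷ bs) ≡ just _ → last ((a ∷ as) ++ bs) ≡ just _
    last-++ []       last′≡ = trans (cong last (++-identityʳ (a ∷ as))) (trans last≡ last′≡)
    last-++ (b ∷ bs) last′≡ = trans (last-++-∷ (a ∷ as) b bs) last′≡

  straightPath-∷ : ∀ {k w us} → StraightPath F p k w us → ∃[ bs ] StraightPath F p k w (k ∷ bs)
  straightPath-∷ {us = k ∷ bs} s@((refl , _) , _) = bs , s

  straightPath-++ : ∀ {v k w as bs} → v ≢ w → InOpenSeg F (p k) (p v) (p w) →
    StraightPath F p v k as → StraightPath F p k w (k ∷ bs) → StraightPath F p v w (as ++ bs)
  straightPath-++ {v} {k} {w} {as} {bs} v≢w k∈vw (path , on) (path′ , on′) =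
    isPath-++ path path′ (λ j j∈as j∈bs →
      p-injective (closed-meet (distinct v w v≢w) k∈vw (to (on j) j∈as) (to (on′ j) j∈bs))) ,
    λ j → mk⇔ (λ j∈ → [ (λ j∈as → closed-shrinkʳ k∈vw (to (on j) j∈as))
                       , (λ j∈bs → closed-shrinkˡ k∈vw (to (on′ j) (there j∈bs))) ]′ (∈-++⁻ as j∈))
              (λ j∈vw → [ (λ j∈vk → ∈-++⁺ˡ (from (on j) j∈vk)) , (λ j∈kw → member (from (on′ j) j∈kw)) ]′
                          (closed-split k∈vw j∈vw))
    where
    member : ∀ {j} → j ∈ k ∷ bs → j ∈ as ++ bs
    member (here refl)  = ∈-++⁺ˡ (from (on k) (closed-end (p v) (p k)))
    member (there j∈bs) = ∈-++⁺ʳ as j∈bs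

  -- Any point of the segment splits it; cs bounds the points still available.
  straightPath-within : ∀ cs v w → v ≢ w → (∀ k → InOpenSeg F (p k) (p v) (p w) → k ∈ cs) →
                        ∃[ us ] StraightPath F p v w us
  straightPath-within [] v w v≢w none = v ∷ w ∷ [] ,
    (refl , refl , (v≢w , λ k k∈vw → contradiction (none k k∈vw) λ ()) ∷ [-] , (v≢w ∷ []) ∷ [] ∷ []) ,
    λ k → mk⇔ (λ { (here refl) → closed-start (p v) (p w) ; (there (here refl)) → closed-end (p v) (p w) })
              λ k∈ → [ (λ k≈v → here (p-injective k≈v))
                     , [ (λ k≈w → there (here (p-injective k≈w)))
                       , (λ k∈vw → contradiction (none k k∈vw) λ ()) ]′ ]′ (closed-cases k∈)
  straightPath-within (c ∷ cs) v w v≢w all∈ with inOpenSeg? (p c) (distinct v w v≢w)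
  ... | no c∉vw = straightPath-within cs v w v≢w λ k k∈vw → drop (all∈ k k∈vw) k∈vw
    where
    drop : ∀ {k} → k ∈ c ∷ cs → InOpenSeg F (p k) (p v) (p w) → k ∈ cs
    drop (here refl) c∈vw = contradiction c∈vw c∉vw
    drop (there k∈)  _    = k∈
  ... | yes c∈vw = split (straightPath-within cs v c v≢c on-vc) (straightPath-within cs c w c≢w on-cw)
    where
    open-≢start : ∀ {i j k} → i ≢ j → InOpenSeg F (p k) (p i) (p j) → k ≢ i
    open-≢start i≢j k∈ij refl = open≉start (distinct _ _ i≢j) k∈ij ≈ₚ-refl
    open-≢end : ∀ {i j k} → i ≢ j → InOpenSeg F (p k) (p i) (p j) → k ≢ j
    open-≢end i≢j k∈ij refl = open≉end (distinct _ _ i≢j) k∈ij ≈ₚ-refl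

    v≢c : v ≢ c
    v≢c v≡c = open-≢start v≢w c∈vw (sym v≡c)
    c≢w : c ≢ w
    c≢w = open-≢end v≢w c∈vw

    drop : ∀ {k} → k ∈ c ∷ cs → k ≢ c → k ∈ cs
    drop (here k≡c) k≢c = contradiction k≡c k≢c
    drop (there k∈) _   = k∈

    -- `c` is interior to neither half, so both recursive calls can use the shorter list `cs`.
    on-vc : ∀ k → InOpenSeg F (p k) (p v) (p c) → k ∈ cs
    on-vc k k∈vc = drop (all∈ k (open-shrinkʳ c∈vw k∈vc)) (open-≢end v≢c k∈vc)
    on-cw : ∀ k → InOpenSeg F (p k) (p c) (p w) → k ∈ cs
    on-cw k k∈cw = drop (all∈ k (open-shrinkˡ c∈vw k∈cw)) (open-≢start c≢w k∈cw)

    split : ∃[ as ] StraightPath F p v c as → ∃[ bs ] StraightPath F p c w bs → ∃[ us ] StraightPath F p v w us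
    split (as , straight) (_ , straight′) with bs , straight″ ← straightPath-∷ straight′ =
      as ++ bs , straightPath-++ v≢w c∈vw straight straight″

  straightPath : ∀ v w → v ≢ w → ∃[ us ] StraightPath F p v w us
  straightPath v w v≢w = straightPath-within (allFin n) v w v≢w (λ k _ → ∈-allFin k)

  OnLine : Fin n → Fin n → Fin n → Fin n → Set
  OnLine v w a b = col v w a × col v w b

  -- Makes the edge `a b` the base of the line. If two paths use the same edge, the ends of the
  -- segments concerned all fall on the single line `a b`.
  onLine-start : ∀ {v w a b} → v ≢ w → OnLine v w a b → col a b v
  onLine-start {v} {w} {a} {b} v≢w (vwa , vwb) = col-line a b v v≢w vwa vwb (collinear-aba (p v) (p w))

  onLine-end : ∀ {v w a b} → v ≢ w → OnLine v w a b → col a b w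
  onLine-end {v} {w} {a} {b} v≢w (vwa , vwb) = col-line a b w v≢w vwa vwb (collinear-abb (p v) (p w))

  consecutive-∈ : ∀ {a b us} → Consecutive F p a b us → a ∈ us × b ∈ us
  consecutive-∈ (xs , ys , refl) = ∈-insert xs , ∈-++⁺ʳ xs (there (here refl))

  consecutive-++ : ∀ {a b x} as {bs} → last as ≡ just x → Consecutive F p a b (as ++ bs) →
                   Consecutive F p a b as ⊎ Consecutive F p a b (x ∷ bs)
  consecutive-++ (x ∷ [])       refl  c                     = inj₂ c
  consecutive-++ (c ∷ d ∷ as)   last≡ ([] , _ , refl)       = inj₁ ([] , as , refl)
  consecutive-++ (c ∷ d ∷ as)   last≡ (_ ∷ xs , ys , us≡)
    with consecutive-++ (d ∷ as) last≡ (xs , ys , ∷-injectiveʳ us≡)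
  ... | inj₁ (xs′ , ys′ , eq) = inj₁ (c ∷ xs′ , ys′ , cong (c ∷_) eq)
  ... | inj₂ later            = inj₂ later

  usesEdge-++ : ∀ {a b x} as {bs} → last as ≡ just x → UsesEdge F p a b (as ++ bs) →
                UsesEdge F p a b as ⊎ UsesEdge F p a b (x ∷ bs)
  usesEdge-++ as last≡ (inj₁ c) = Sum.map inj₁ inj₁ (consecutive-++ as last≡ c)
  usesEdge-++ as last≡ (inj₂ c) = Sum.map inj₂ inj₂ (consecutive-++ as last≡ c)

  -- An edge must have distinct ends to determine a line; visibility includes this.
  usesEdge-≢ : ∀ {v w us a b} → IsPath F p v w us → UsesEdge F p a b us → a ≢ b
  usesEdge-≢ (_ , _ , linked , _) = [ ≢ linked , (λ c a≡b → ≢ linked c (sym a≡b)) ]′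
    where
    ≢ : ∀ {us a b} → Linked (Visible F p) us → Consecutive F p a b us → a ≢ b
    ≢ ((a≢b , _) ∷ _) ([] , _ , refl)         = a≢b
    ≢ [-]             (_ ∷ [] , _ , ())
    ≢ [-]             (_ ∷ _ ∷ _ , _ , ())
    ≢ (_ ∷ l)         (_ ∷ xs , ys , eq)      = ≢ l (xs , ys , ∷-injectiveʳ eq)

  straightPath-edge : ∀ {v w us a b} → StraightPath F p v w us → UsesEdge F p a b us → OnLine v w a b
  straightPath-edge {v} {w} {us} (_ , on) = [ onLine , (λ c → let b , a = onLine c in a , b) ]′
    where
    onLine : ∀ {a b} → Consecutive F p a b us → OnLine v w a b
    onLine c = let a∈ , b∈ = consecutive-∈ c in closed⇒collinear (to (on _) a∈) , closed⇒collinear (to (on _) b∈)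

  consecutive? : ∀ a b us → Dec (Consecutive F p a b us)
  consecutive? a b []           = no λ { ([] , _ , ()) ; (_ ∷ _ , _ , ()) }
  consecutive? a b (x ∷ [])     = no λ { ([] , _ , ()) ; (_ ∷ [] , _ , ()) ; (_ ∷ _ ∷ _ , _ , ()) }
  consecutive? a b (x ∷ y ∷ us) = map′
    (λ { (inj₁ (refl , refl)) → [] , us , refl ; (inj₂ (xs , ys , eq)) → x ∷ xs , ys , cong (x ∷_) eq })
    (λ { ([] , _ , refl) → inj₁ (refl , refl) ; (_ ∷ xs , ys , eq) → inj₂ (xs , ys , ∷-injectiveʳ eq) })
    ((a Fin.≟ x ×-dec b Fin.≟ y) ⊎-dec consecutive? a b (y ∷ us))

  usesEdge? : ∀ a b us → Dec (UsesEdge F p a b us)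
  usesEdge? a b us = consecutive? a b us ⊎-dec consecutive? b a us

-- Edge-disjoint one-bend paths from a matching, and edge-connectivity

map-proj₁-toList : ∀ {A : Set} {P : Pred A 0ℓ} {xs} (pxs : All P xs) → map proj₁ (All.toList pxs) ≡ xs
map-proj₁-toList []         = refl
map-proj₁-toList (px ∷ pxs) = cong (_ ∷_) (map-proj₁-toList pxs)

AllPairs-lookup : ∀ {A : Set} {R : Rel A 0ℓ} → (∀ {x y} → R x y → R y x) → ∀ {xs} → AllPairs R xs →
                  ∀ i j → i ≢ j → R (lookup xs i) (lookup xs j)
AllPairs-lookup R-sym (_ ∷ _)   zero    zero    i≢j = contradiction refl i≢j
AllPairs-lookup R-sym (Rx ∷ _)  zero    (suc j) i≢j = All.lookup Rx (∈-lookup j)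
AllPairs-lookup R-sym (Rx ∷ _)  (suc i) zero    i≢j = R-sym (All.lookup Rx (∈-lookup i))
AllPairs-lookup R-sym (_ ∷ Rxs) (suc i) (suc j) i≢j = AllPairs-lookup R-sym Rxs i j (λ i≡j → i≢j (cong suc i≡j))

⌈m/n⌉≤o : ∀ {m} n {o} .{{_ : ℕ.NonZero n}} → m ≤ o * n → ⌈ m / n ⌉ ≤ o
⌈m/n⌉≤o {m} (suc b) {o} m≤on = ≤-pred (m<n*o⇒m/o<n {m + b} {suc o} {suc b} (s≤s (begin
  m + b                  ≤⟨ +-monoˡ-≤ b m≤on ⟩
  o * suc b + b          ≡⟨ +-comm _ b ⟩
  b + o * suc b          ∎)))
  where open ≤-Reasoning

module _ (F : OrderedField) {n : ℕ} (p : Fin n → Point F) (distinct : Distinct F p) where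
  open Geometry F
  open VisibilityGraph F p distinct

  EdgeDisjointPaths : ℕ → Fin n → Fin n → Set
  EdgeDisjointPaths k v w = Σ (Fin k → List (Fin n)) λ paths →
    (∀ i → OneBendPath F p v w (paths i)) × (∀ i j → i ≢ j → EdgeDisjoint F p (paths i) (paths j))

  edgeDisjointPaths-≤ : ∀ {k l v w} → k ≤ l → EdgeDisjointPaths l v w → EdgeDisjointPaths k v w
  edgeDisjointPaths-≤ k≤l (paths , oneBend , disjoint) =
    (λ i → paths (inject≤ i k≤l)) , (λ i → oneBend (inject≤ i k≤l)) ,
    λ i j i≢j → disjoint _ _ (λ eq → i≢j (Fin.inject≤-injective k≤l k≤l i j eq))

  edgeDisjoint-sym : ∀ {us vs} → EdgeDisjoint F p us vs → EdgeDisjoint F p vs us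
  edgeDisjoint-sym disjoint a b uses-vs uses-us = disjoint a b uses-us uses-vs

  edgeConnected : ∀ {k} → (∀ v w → v ≢ w → EdgeDisjointPaths k v w) → EdgeConnected F p k
  edgeConnected paths E ∣E∣<k v w with v Fin.≟ w
  ... | yes refl = v ∷ [] , (refl , refl , [-] , [] ∷ []) ,
    λ a b → [ (λ c → contradiction c noEdge) , (λ c → contradiction c noEdge) ]′
    where
    noEdge : ∀ {a b} → ¬ Consecutive F p a b (v ∷ [])
    noEdge ([] , _ , ())
    noEdge (_ ∷ [] , _ , ())
    noEdge (_ ∷ _ ∷ _ , _ , ())
  ... | no v≢w with us , oneBend , disjoint ← paths v w v≢w
               with Fin.any? (λ i → ¬? (Any.any? (λ e → usesEdge? (proj₁ e) (proj₂ e) (us i)) E))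
  ...   | yes (i , avoids) = us i , proj₁ (oneBend i) ,
    λ a b uses ab∈E → avoids (Any.map (λ { refl → uses }) ab∈E)
  -- If no path avoids `E`, send each path to a deleted edge that it uses. Two of the `k` paths get
  -- the same edge, against disjointness.
  ...   | no none = contradiction (Fin.pigeonhole ∣E∣<k (λ i → Any.index (hit i))) clash
    where
    hit : ∀ i → Any (λ e → UsesEdge F p (proj₁ e) (proj₂ e) (us i)) E
    hit i = decidable-stable (Any.any? (λ e → usesEdge? (proj₁ e) (proj₂ e) (us i)) E) (λ ¬hit → none (i , ¬hit))
    clash : ¬ (∃[ i ] ∃[ j ] (i Fin.< j × Any.index (hit i) ≡ Any.index (hit j)))
    clash (i , j , i<j , same) = disjoint i j (λ { refl → <-irrefl refl i<j }) _ _
      (Any.lookup-index (hit i))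
      (subst (λ k → UsesEdge F p (proj₁ (lookup E k)) (proj₂ (lookup E k)) (us j)) (sym same)
             (Any.lookup-index (hit j)))

  module _ {Δ : ℕ} (atMost : AtMostCollinear F p (suc Δ)) {v w : Fin n} (v≢w : v ≢ w) where

    OffLine : Set
    OffLine = ∃[ x ] (¬ col v w x)

    v≢off : ((x , _) : OffLine) → v ≢ x
    v≢off (_ , off) refl = off (collinear-aba _ _)

    w≢off : ((x , _) : OffLine) → w ≢ x
    w≢off (_ , off) refl = off (collinear-abb _ _)

    off≢w : ((x , _) : OffLine) → x ≢ w
    off≢w x x≡w = w≢off x (sym x≡w)

    SameLineThrough : Fin n → Rel OffLine 0ℓ
    SameLineThrough u (x , _) (y , _) = col u x y

    sameLineThrough-isDecEquivalence : ∀ u → ((x : OffLine) → u ≢ proj₁ x) → IsDecEquivalence (SameLineThrough u)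
    sameLineThrough-isDecEquivalence u u≢off = record
      { isEquivalence = record
        { refl  = collinear-abb _ _
        ; sym   = collinear-swap _ _ _
        ; trans = λ {x} {y} {z} uxy uyz → col-line u (proj₁ x) (proj₁ z) (u≢off y)
                    (collinear-aba _ _) (collinear-swap _ _ _ uxy) uyz
        }
      ; _≟_ = λ x y → collinear? _ _ _
      }

    v-lines = sameLineThrough-isDecEquivalence v v≢off
    w-lines = sameLineThrough-isDecEquivalence w w≢off

    onLine? : Decidable (col v w)
    onLine? x = collinear? _ _ _

    offLine : List OffLine
    offLine = All.toList (All.all-filter (λ x → ¬? (onLine? x)) (allFin n))

    -- Stated for the points alone, since collinearity bounds count points and not their proofs of
    -- being off the line.
    unique-offLine : AllPairs (λ x y → proj₁ x ≢ proj₁ y) offLine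
    unique-offLine = AllPairs.map⁻ (subst Unique
      (sym (map-proj₁-toList (All.all-filter (λ x → ¬? (onLine? x)) (allFin n))))
      (Unique.filter⁺ (λ x → ¬? (onLine? x)) (Unique.allFin⁺ n)))

    n≤onLine+offLine : n ≤ suc Δ + length offLine
    n≤onLine+offLine = begin
      n                                                              ≡⟨ length-tabulate (λ i → i) ⟨
      length (allFin n)                                              ≡⟨ length-filter-split onLine? (allFin n) ⟨
      length on + length (filter (λ x → ¬? (onLine? x)) (allFin n))  ≡⟨ cong (length on +_) (trans
        (cong length (sym (map-proj₁-toList (All.all-filter (λ x → ¬? (onLine? x)) (allFin n)))))
        (length-map proj₁ offLine)) ⟩
      length on + length offLine                                     ≤⟨ +-monoˡ-≤ (length offLine) (atMost on
        (Unique.filter⁺ onLine? (Unique.allFin⁺ n))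
        (λ i∈ j∈ k∈ → col-line _ _ _ v≢w (member i∈) (member j∈) (member k∈))) ⟩
      suc Δ + length offLine                                         ∎
      where
      open ≤-Reasoning
      on = filter onLine? (allFin n)
      member : ∀ {i} → i ∈ on → col v w i
      member i∈ = proj₂ (∈-filter⁻ onLine? {xs = allFin n} i∈)

    -- The line through `u` and `c` also contains `u`, which is not in the class; this leaves at
    -- most `Δ` of the `suc Δ` places.
    boundedDegree : ∀ u (u≢off : (x : OffLine) → u ≢ proj₁ x) →
      BoundedDegree (IsDecEquivalence._≟_ (sameLineThrough-isDecEquivalence u u≢off)) Δ offLine
    boundedDegree u u≢off c = ≤-pred (≤-trans (≤-reflexive (cong suc (sym (length-map proj₁ line))))
      (atMost (u ∷ map proj₁ line)
        (All.map⁺ (All.tabulate (λ {x} _ → u≢off x)) ∷ AllPairs.map⁺ (AllPairs.filter⁺ line? unique-offLine))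
        (λ i∈ j∈ k∈ → col-line _ _ _ (u≢off c) (member i∈) (member j∈) (member k∈))))
      where
      line? = λ x → IsDecEquivalence._≟_ (sameLineThrough-isDecEquivalence u u≢off) x c
      line = filter line? offLine
      member : ∀ {i} → i ∈ u ∷ map proj₁ line → col u (proj₁ c) i
      member (here refl) = collinear-aba _ _
      member (there i∈) with x , x∈ , refl ← ∈-map⁻ proj₁ i∈ =
        collinear-swap _ _ _ (proj₂ (∈-filter⁻ line? {xs = offLine} x∈))

    BendEdge : OffLine → Fin n → Fin n → Set
    BendEdge (x , _) a b = OnLine v x a b ⊎ OnLine x w a b

    BendPath : OffLine → Set
    BendPath X = ∃[ us ] (OneBendPath F p v w us × (∀ a b → UsesEdge F p a b us → BendEdge X a b))

    bendPath : ∀ X → BendPath X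
    bendPath X@(x , off) = join (straightPath v x (v≢off X)) (straightPath x w (off≢w X))
      where
      -- A second common point `j` of the lines `v x` and `x w` would put `v`, `w` and `x` all on
      -- the line `x j`.
      triangle : ∀ j → col v x j → col x w j → j ≡ x
      triangle j vxj xwj = decidable-stable (j Fin.≟ x) λ j≢x → off
        (col-line v w x (λ x≡j → j≢x (sym x≡j))
          (collinear-swap (p x) (p v) (p j)
            (col-line x v j (v≢off X) (collinear-abb (p v) (p x)) (collinear-aba (p v) (p x)) vxj))
          (collinear-swap (p x) (p w) (p j) xwj)
          (collinear-aba (p x) (p j)))

      join : ∃[ as ] StraightPath F p v x as → ∃[ bs ] StraightPath F p x w bs → BendPath X
      join (as , vx) (_ , xw′) with bs , xw ← straightPath-∷ xw′ =
        as ++ bs ,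
        (isPath-++ (proj₁ vx) (proj₁ xw) (λ j j∈as j∈bs → triangle j
            (closed⇒collinear (to (proj₂ vx j) j∈as)) (closed⇒collinear (to (proj₂ xw j) j∈bs))) ,
         inj₂ (x , as , bs , refl , vx , xw)) ,
        λ a b uses → Sum.map (straightPath-edge vx) (straightPath-edge xw)
                       (usesEdge-++ as (proj₁ (proj₂ (proj₁ vx))) uses)

    -- Everything lies on the line `a b`. Two first legs put `v`, `x`, `y` on it and two second legs
    -- put `w`, `x`, `y` on it, against independence. A first and a second leg put `v`, `w`, `x` on
    -- it, against `x` being off `v w`, even if `x` and `y` coincide.
    bendEdges-disjoint : ∀ {a b} → a ≢ b → ∀ X Y → Independent (SameLineThrough v) (SameLineThrough w) X Y →
                         BendEdge X a b → ¬ BendEdge Y a b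
    bendEdges-disjoint a≢b X@(x , _) Y@(y , _) (¬vxy , _) (inj₁ vx) (inj₁ vy) = ¬vxy
      (col-line v x y a≢b (onLine-start (v≢off X) vx) (onLine-end (v≢off X) vx) (onLine-end (v≢off Y) vy))
    bendEdges-disjoint a≢b X@(x , off) Y _ (inj₁ vx) (inj₂ yw) = off
      (col-line v w x a≢b (onLine-start (v≢off X) vx) (onLine-end (off≢w Y) yw) (onLine-end (v≢off X) vx))
    bendEdges-disjoint a≢b X@(x , off) Y _ (inj₂ xw) (inj₁ vy) = off
      (col-line v w x a≢b (onLine-start (v≢off Y) vy) (onLine-end (off≢w X) xw) (onLine-start (off≢w X) xw))
    bendEdges-disjoint a≢b X@(x , _) Y@(y , _) (_ , ¬wxy) (inj₂ xw) (inj₂ yw) = ¬wxy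
      (col-line w x y a≢b (onLine-end (off≢w X) xw) (onLine-start (off≢w X) xw) (onLine-start (off≢w Y) yw))

    bendPaths-disjoint : ∀ X Y → Independent (SameLineThrough v) (SameLineThrough w) X Y →
      (πX : BendPath X) (πY : BendPath Y) → EdgeDisjoint F p (proj₁ πX) (proj₁ πY)
    bendPaths-disjoint X Y ind (_ , bend , edges) (_ , _ , edges′) a b uses uses′ =
      bendEdges-disjoint (usesEdge-≢ (proj₁ bend) uses) X Y ind (edges a b uses) (edges′ a b uses′)

    straight-bend-disjoint : ∀ {us} → StraightPath F p v w us → ∀ X (πX : BendPath X) → EdgeDisjoint F p us (proj₁ πX)
    straight-bend-disjoint vw X@(x , off) (_ , _ , edges) a b uses uses′ =
      [ (λ vx → off (col-line v w x a≢b abv abw (onLine-end (v≢off X) vx)))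
      , (λ xw → off (col-line v w x a≢b abv abw (onLine-start (off≢w X) xw))) ]′ (edges a b uses′)
      where
      a≢b : a ≢ b
      a≢b = usesEdge-≢ (proj₁ vw) uses
      abv : col a b v
      abv = onLine-start v≢w (straightPath-edge vw uses)
      abw : col a b w
      abw = onLine-end v≢w (straightPath-edge vw uses)

    Independent-sym : ∀ X Y → Independent (SameLineThrough v) (SameLineThrough w) X Y →
                      Independent (SameLineThrough v) (SameLineThrough w) Y X
    Independent-sym (x , _) (y , _) (¬vxy , ¬wxy) =
      (λ vyx → ¬vxy (collinear-swap (p v) (p y) (p x) vyx)) , (λ wyx → ¬wxy (collinear-swap (p w) (p y) (p x) wyx))

    pathsFromMatching : ∀ M → AllPairs (Independent (SameLineThrough v) (SameLineThrough w)) M →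
                        EdgeDisjointPaths (suc (length M)) v w
    pathsFromMatching M ind = paths , oneBend , disjoint
      where
      vw : ∃[ us ] StraightPath F p v w us
      vw = straightPath v w v≢w
      paths : Fin (suc (length M)) → List (Fin n)
      paths zero    = proj₁ vw
      paths (suc i) = proj₁ (bendPath (lookup M i))
      oneBend : ∀ i → OneBendPath F p v w (paths i)
      oneBend zero    = proj₁ (proj₂ vw) , inj₁ (proj₂ vw)
      oneBend (suc i) = proj₁ (proj₂ (bendPath (lookup M i)))
      disjoint : ∀ i j → i ≢ j → EdgeDisjoint F p (paths i) (paths j)
      disjoint zero    zero    i≢j = contradiction refl i≢j
      disjoint zero    (suc j) _   = straight-bend-disjoint (proj₂ vw) (lookup M j) (bendPath (lookup M j))
      disjoint (suc i) zero    _   = edgeDisjoint-sym {paths zero}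
        (straight-bend-disjoint (proj₂ vw) (lookup M i) (bendPath (lookup M i)))
      disjoint (suc i) (suc j) i≢j = bendPaths-disjoint (lookup M i) (lookup M j)
        (AllPairs-lookup (λ {X} {Y} → Independent-sym X Y) ind i j (λ i≡j → i≢j (cong suc i≡j)))
        (bendPath (lookup M i)) (bendPath (lookup M j))

    edgeDisjointPaths : .{{_ : ℕ.NonZero Δ}} → EdgeDisjointPaths ⌈ n ∸ 1 / Δ ⌉ v w
    edgeDisjointPaths =
      fromMatching (largeMatching v-lines w-lines Δ offLine (boundedDegree v v≢off) (boundedDegree w w≢off))
      where
      open ≤-Reasoning
      fromMatching : ∃[ M ] (All (_∈ offLine) M × AllPairs (Independent (SameLineThrough v) (SameLineThrough w)) M ×
                             length offLine ≤ length M * Δ) → EdgeDisjointPaths ⌈ n ∸ 1 / Δ ⌉ v w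
      -- Of the `suc Δ` possible points on `v w`, the subtraction of 1 leaves `Δ`, exactly the share
      -- of the straight path in `suc (length M) * Δ`.
      fromMatching (M , _ , ind , off≤M) = edgeDisjointPaths-≤ (⌈m/n⌉≤o Δ (begin
        n ∸ 1                     ≤⟨ ∸-monoˡ-≤ 1 n≤onLine+offLine ⟩
        Δ + length offLine        ≤⟨ +-monoʳ-≤ Δ off≤M ⟩
        suc (length M) * Δ        ∎)) (pathsFromMatching M ind)

-- Points on rays

≡-mod : ∀ {n m m′} x y .{{_ : NonZero n}} → m < n → m′ < n → m + x * n ≡ m′ + y * n → m ≡ m′
≡-mod {n} {m} {m′} x y m<n m′<n eq = begin
  m                   ≡⟨ m<n⇒m%n≡m m<n ⟨
  m % n               ≡⟨ [m+kn]%n≡m%n m x n ⟨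
  (m + x * n) % n     ≡⟨ cong (_% n) eq ⟩
  (m′ + y * n) % n    ≡⟨ [m+kn]%n≡m%n m′ y n ⟩
  m′ % n              ≡⟨ m<n⇒m%n≡m m′<n ⟩
  m′                  ∎
  where open ≡.≡-Reasoning

another : ∀ {m} → 3 ≤ m → (i j : Fin m) → ∃[ k ] (k ≢ i × k ≢ j)
another (s≤s (s≤s (s≤s _))) zero          zero          = suc zero , (λ ()) , λ ()
another (s≤s (s≤s (s≤s _))) zero          (suc zero)    = suc (suc zero) , (λ ()) , λ ()
another (s≤s (s≤s (s≤s _))) zero          (suc (suc _)) = suc zero , (λ ()) , λ ()
another (s≤s (s≤s (s≤s _))) (suc zero)    zero          = suc (suc zero) , (λ ()) , λ ()
another (s≤s (s≤s (s≤s _))) (suc (suc _)) zero          = suc zero , (λ ()) , λ ()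
another (s≤s (s≤s (s≤s _))) (suc _)       (suc _)       = zero , (λ ()) , λ ()

-- The collinearity determinant of three points of ℕ², with the negative
-- terms moved to the other side.
Collinearℕ : ℕ × ℕ → ℕ × ℕ → ℕ × ℕ → Set
Collinearℕ (x₁ , y₁) (x₂ , y₂) (x₃ , y₃) =
  x₂ * y₃ + x₁ * y₂ + x₃ * y₁ ≡ x₃ * y₂ + x₂ * y₁ + x₁ * y₃

module _ (base : ℕ) .{{base≢0 : NonZero base}} where

  -- Abscissas 1 : base * t : base * t * base * u up to the factor s; dividing
  -- by the smallest monomial leaves a congruence modulo base of the slopes.
  slopes-equal : ∀ {s t u m₁ m₂ m₃} .{{_ : NonZero s}} .{{_ : NonZero t}} .{{_ : NonZero u}} →
    let s₂ = s * (base * t) ; s₃ = s₂ * (base * u) in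
    m₁ < base → m₂ < base → m₃ < base →
    Collinearℕ (s , m₁ * s) (s₂ , m₂ * s₂) (s₃ , m₃ * s₃) → m₁ ≡ m₂ × m₂ ≡ m₃
  slopes-equal {s} {t} {u} {m₁} {m₂} {m₃} {{s≢0}} {{t≢0}} m₁< m₂< m₃< col = m₁≡m₂ , m₂≡m₃
    where
    c = s * (s * (base * t))
    c≢0 : NonZero c
    c≢0 = m*n≢0 s (s * (base * t)) {{s≢0}} {{m*n≢0 s (base * t) {{s≢0}} {{m*n≢0 base t {{base≢0}} {{t≢0}}}}}}

    reduced : m₂ + (t * base * u * m₃ + u * m₁) * base ≡ m₁ + (t * base * u * m₂ + u * m₃) * base
    reduced = *-cancelˡ-≡ _ _ c {{c≢0}} (trans (sym (lhs base s t u m₁ m₂ m₃)) (trans col (rhs base s t u m₁ m₂ m₃)))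
      where
      lhs : ∀ b s t u m₁ m₂ m₃ →
        s * (b * t) * (m₃ * (s * (b * t) * (b * u))) + s * (m₂ * (s * (b * t))) + s * (b * t) * (b * u) * (m₁ * s) ≡
        s * (s * (b * t)) * (m₂ + (t * b * u * m₃ + u * m₁) * b)
      lhs = solve-∀
      rhs : ∀ b s t u m₁ m₂ m₃ →
        s * (b * t) * (b * u) * (m₂ * (s * (b * t))) + s * (b * t) * (m₁ * s) + s * (m₃ * (s * (b * t) * (b * u))) ≡
        s * (s * (b * t)) * (m₁ + (t * b * u * m₂ + u * m₃) * b)
      rhs = solve-∀

    m₁≡m₂ : m₁ ≡ m₂
    m₁≡m₂ = sym (≡-mod (t * base * u * m₃ + u * m₁) (t * base * u * m₂ + u * m₃) m₂< m₁< reduced)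

    -- Once m₁ = m₂, the lowest terms cancel and the rest is divisible by `base` and `u`. Dividing
    -- exposes a second congruence modulo `base`.
    m₂≡m₃ : m₂ ≡ m₃
    m₂≡m₃ = ≡-mod (t * m₃) (t * m₂) m₂< m₃< (*-cancelˡ-≡ _ _ u
      (trans (lhs base t u m₂ m₃) (trans reduced′ (sym (rhs base t u m₂ m₃)))))
      where
      reduced′ : t * base * u * m₃ + u * m₂ ≡ t * base * u * m₂ + u * m₃
      reduced′ = *-cancelʳ-≡ _ _ base (+-cancelˡ-≡ m₂ _ _
        (subst (λ m → m₂ + (t * base * u * m₃ + u * m) * base ≡ m + (t * base * u * m₂ + u * m₃) * base) m₁≡m₂ reduced))
      lhs : ∀ b t u m₂ m₃ → u * (m₂ + t * m₃ * b) ≡ t * b * u * m₃ + u * m₂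
      lhs = solve-∀
      rhs : ∀ b t u m₂ m₃ → u * (m₃ + t * m₂ * b) ≡ t * b * u * m₂ + u * m₃
      rhs = solve-∀

  onRay : ℕ → ℕ → ℕ × ℕ
  onRay m k = base ^ k , m * base ^ k

  ^-split : ∀ {k l} → k < l → base ^ l ≡ base ^ k * (base * base ^ (l ℕ.∸ suc k))
  ^-split {k} {l} k<l = trans (cong (base ^_) (sym (trans (+-suc k _) (m+[n∸m]≡n k<l)))) (^-distribˡ-+-* base k _)

  slopes-equal-ordered : ∀ {m₁ m₂ m₃ k₁ k₂ k₃} → k₁ < k₂ → k₂ < k₃ → m₁ < base → m₂ < base → m₃ < base →
    Collinearℕ (onRay m₁ k₁) (onRay m₂ k₂) (onRay m₃ k₃) → m₁ ≡ m₂ × m₂ ≡ m₃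
  slopes-equal-ordered {k₁ = k₁} {k₂} {k₃} k₁<k₂ k₂<k₃ m₁< m₂< m₃< col
    rewrite ^-split k₂<k₃ | ^-split k₁<k₂ =
    slopes-equal {{m^n≢0 base k₁}} {{m^n≢0 base (k₂ ℕ.∸ suc k₁)}} {{m^n≢0 base (k₃ ℕ.∸ suc k₂)}} m₁< m₂< m₃< col

-- The ray configuration and the degree of the origin

module _ (F : OrderedField) where
  private
    module F = OrderedFieldProperties F
  open F using (_≈_; 0#; 1#; -_; fromℕ; fromℕ-+; fromℕ-*; fromℕ-injective; fromℕ-mono-<; solve; _:=_; _:+_; _:*_;
    _:-_; :-_; :0; :1; linear₁; inverse; inverse-pos; *-pos; >⇒≉; reflexive; <-resp-≈; +-cong; +-congˡ; +-congʳ; *-congˡ)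
  open Geometry F

  fromℕ² : ℕ × ℕ → Point F
  fromℕ² (x , y) = fromℕ x , fromℕ y

  collinear⇒collinearℕ : ∀ a b c → Collinear F (fromℕ² a) (fromℕ² b) (fromℕ² c) → Collinearℕ a b c
  collinear⇒collinearℕ (x₁ , y₁) (x₂ , y₂) (x₃ , y₃) col = fromℕ-injective
    (F.trans (sums x₂ y₃ x₁ y₂ x₃ y₁) (F.trans determinant (F.sym (sums x₃ y₂ x₂ y₁ x₁ y₃))))
    where
    X₁ = fromℕ x₁ ; X₂ = fromℕ x₂ ; X₃ = fromℕ x₃ ; Y₁ = fromℕ y₁ ; Y₂ = fromℕ y₂ ; Y₃ = fromℕ y₃
    determinant : X₂ F.* Y₃ F.+ X₁ F.* Y₂ F.+ X₃ F.* Y₁ ≈ X₃ F.* Y₂ F.+ X₂ F.* Y₁ F.+ X₁ F.* Y₃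
    determinant = linear₁ 1# col (solve 6 (λ X₁ X₂ X₃ Y₁ Y₂ Y₃ →
      X₂ :* Y₃ :+ X₁ :* Y₂ :+ X₃ :* Y₁ :- (X₃ :* Y₂ :+ X₂ :* Y₁ :+ X₁ :* Y₃) :=
      :1 :* ((X₂ :- X₁) :* (Y₃ :- Y₁) :- (Y₂ :- Y₁) :* (X₃ :- X₁))) F.refl X₁ X₂ X₃ Y₁ Y₂ Y₃)
    sums : ∀ a b c d e f → fromℕ (a * b + c * d + e * f) ≈
           fromℕ a F.* fromℕ b F.+ fromℕ c F.* fromℕ d F.+ fromℕ e F.* fromℕ f
    sums a b c d e f = F.trans (fromℕ-+ (a * b + c * d) (e * f)) (+-cong
      (F.trans (fromℕ-+ (a * b) (c * d)) (+-cong (fromℕ-* a b) (fromℕ-* c d))) (fromℕ-* e f))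

  -- The origin together with q + 1 points on each of d rays.  The points are
  -- numbered ray by ray, and point number k has abscissa base ^ k.
  module Rays (d q : ℕ) where

    -- At least 2, so that powers increase strictly, and above every slope, so that slopes congruent
    -- modulo `base` are equal.
    base : ℕ
    base = suc (suc d)

    ray : Fin (d * suc q) → Fin d
    ray k = proj₁ (remQuot (suc q) k)

    position : Fin (d * suc q) → Fin (suc q)
    position k = proj₂ (remQuot {d} (suc q) k)

    ray-position-injective : ∀ {k l} → ray k ≡ ray l → position k ≡ position l → k ≡ l
    ray-position-injective {k} {l} ray≡ position≡ = trans (sym (Fin.combine-remQuot {d} (suc q) k))
      (trans (cong₂ combine ray≡ position≡) (Fin.combine-remQuot {d} (suc q) l))

    slope abscissa : Fin (d * suc q) → ℕ
    slope k    = toℕ (ray k)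
    abscissa k = base ^ toℕ k

    slope<base : ∀ k → slope k < base
    slope<base k = m≤n⇒m≤1+n (m≤n⇒m≤1+n (Fin.toℕ<n (ray k)))

    coordinates : Fin (suc (d * suc q)) → ℕ × ℕ
    coordinates zero    = 0 , 0
    coordinates (suc k) = onRay base (slope k) (toℕ k)

    point : Fin (suc (d * suc q)) → Point F
    point i = fromℕ² (coordinates i)

    abscissa-mono : ∀ {k l} → k Fin.< l → abscissa k < abscissa l
    abscissa-mono k<l = ^-monoʳ-< base (s≤s (s≤s z≤n)) k<l

    abscissa>0 : ∀ k → 0 < abscissa k
    abscissa>0 k = m^n>0 base (toℕ k)

    distinct : Distinct F point
    distinct zero    zero    i≢j _ = i≢j refl
    distinct zero    (suc l) _   (x≈ , _) = <⇒≢ (abscissa>0 l) (fromℕ-injective x≈)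
    distinct (suc k) zero    _   (x≈ , _) = <⇒≢ (abscissa>0 k) (sym (fromℕ-injective x≈))
    distinct (suc k) (suc l) i≢j (x≈ , _) with Fin.<-cmp k l
    ... | tri< k<l _ _ = <⇒≢ (abscissa-mono k<l) (fromℕ-injective x≈)
    ... | tri≈ _ k≡l _ = i≢j (cong suc k≡l)
    ... | tri> _ _ l<k = <⇒≢ (abscissa-mono l<k) (sym (fromℕ-injective x≈))

    colPoint : (i j k : Fin (suc (d * suc q))) → Set
    colPoint i j k = Collinear F (point i) (point j) (point k)

    collinear-origin : ∀ k l → colPoint zero (suc k) (suc l) → ray k ≡ ray l
    collinear-origin k l col = Fin.toℕ-injective (sym (*-cancelˡ-≡ _ _ (abscissa k * abscissa l)
      {{m*n≢0 _ _ {{m^n≢0 base (toℕ k)}} {{m^n≢0 base (toℕ l)}}}}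
      (trans (sym (lhs (abscissa k) (abscissa l) (slope k) (slope l)))
        (trans (collinear⇒collinearℕ (coordinates zero) (coordinates (suc k)) (coordinates (suc l)) col)
               (rhs (abscissa k) (abscissa l) (slope k) (slope l))))))
      where
      lhs : ∀ s t m n → s * (n * t) + 0 * (m * s) + t * 0 ≡ s * t * n
      lhs = solve-∀
      rhs : ∀ s t m n → t * (m * s) + s * 0 + 0 * (n * t) ≡ s * t * m
      rhs = solve-∀

    collinear-ordered : ∀ {k₁ k₂ k₃} → k₁ Fin.< k₂ → k₂ Fin.< k₃ → colPoint (suc k₁) (suc k₂) (suc k₃) →
      ray k₁ ≡ ray k₂ × ray k₂ ≡ ray k₃
    collinear-ordered {k₁} {k₂} {k₃} k₁<k₂ k₂<k₃ col =
      Fin.toℕ-injective (proj₁ slopes) , Fin.toℕ-injective (proj₂ slopes)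
      where
      slopes : slope k₁ ≡ slope k₂ × slope k₂ ≡ slope k₃
      slopes = slopes-equal-ordered base k₁<k₂ k₂<k₃ (slope<base k₁) (slope<base k₂) (slope<base k₃)
        (collinear⇒collinearℕ (coordinates (suc k₁)) (coordinates (suc k₂)) (coordinates (suc k₃)) col)

    -- A third point `i` decides: the origin forces equal slopes directly, any other point after
    -- sorting the three by number. Assuming collinearity for all triples from `P` lets it be
    -- applied in sorted order.
    collinear⇒sameRay : ∀ {P : Fin (suc (d * suc q)) → Set} → (∀ {i j k} → P i → P j → P k → colPoint i j k) →
      ∀ {k l i} → P (suc k) → P (suc l) → P i → i ≢ suc k → i ≢ suc l → ray k ≡ ray l
    collinear⇒sameRay col {k} {l} {zero} Pk Pl Pi _ _ = collinear-origin k l (col Pi Pk Pl)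
    collinear⇒sameRay col {k} {l} {suc i} Pk Pl Pi i≢k i≢l with Fin.<-cmp k l | Fin.<-cmp i k | Fin.<-cmp i l
    ... | tri≈ _ refl _ | _ | _ = refl
    ... | _ | tri≈ _ refl _ | _ = contradiction refl i≢k
    ... | _ | _ | tri≈ _ refl _ = contradiction refl i≢l
    ... | tri< k<l _ _ | tri< i<k _ _ | _            = proj₂ (collinear-ordered i<k k<l (col Pi Pk Pl))
    ... | tri> _ _ l<k | _            | tri< i<l _ _ = sym (proj₂ (collinear-ordered i<l l<k (col Pi Pl Pk)))
    ... | tri< k<l _ _ | tri> _ _ k<i | tri> _ _ l<i = proj₁ (collinear-ordered k<l l<i (col Pk Pl Pi))
    ... | tri> _ _ l<k | tri> _ _ k<i | tri> _ _ l<i = sym (proj₁ (collinear-ordered l<k k<i (col Pl Pk Pi)))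
    ... | tri< _ _ _   | tri> _ _ k<i | tri< i<l _ _ =
      trans (proj₁ (collinear-ordered k<i i<l (col Pk Pi Pl))) (proj₂ (collinear-ordered k<i i<l (col Pk Pi Pl)))
    ... | tri> _ _ _   | tri< i<k _ _ | tri> _ _ l<i =
      sym (trans (proj₁ (collinear-ordered l<i i<k (col Pl Pi Pk))) (proj₂ (collinear-ordered l<i i<k (col Pl Pi Pk))))

    -- A colouring with q + 2 colours for the pigeonhole: distinct points of one colour lie on
    -- different rays, and the origin has a colour to itself.
    level : Fin (suc (d * suc q)) → Fin (suc (suc q))
    level zero    = zero
    level (suc k) = suc (position k)

    -- Among q + 3 points two have the same level, hence lie on different rays,
    -- and are not collinear with any third point.
    atMostCollinear : AtMostCollinear F point (suc (suc q))
    atMostCollinear S unique col with length S ≤? suc (suc q)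
    ... | yes ∣S∣≤ = ∣S∣≤
    ... | no  ∣S∣≰ = contradiction (Fin.pigeonhole ∣S∣> (λ i → level (lookup S i))) clash
      where
      ∣S∣> : suc (suc q) < length S
      ∣S∣> = ≰⇒> ∣S∣≰
      lookup-≢ : ∀ i j → i ≢ j → lookup S i ≢ lookup S j
      lookup-≢ = AllPairs-lookup (λ x≢y y≡x → x≢y (sym y≡x)) unique
      sameLevel : ∀ x y z → x ≢ y → z ≢ x → z ≢ y → x ∈ S → y ∈ S → z ∈ S → level x ≢ level y
      sameLevel zero    zero    z x≢y _ _ _ _ _ _ = x≢y refl
      sameLevel (suc k) (suc l) z x≢y z≢x z≢y x∈ y∈ z∈ level≡ = x≢y (cong suc
        (ray-position-injective (collinear⇒sameRay {_∈ S} col x∈ y∈ z∈ z≢x z≢y) (Fin.suc-injective level≡)))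
      clash : ¬ (∃[ i ] ∃[ j ] (i Fin.< j × level (lookup S i) ≡ level (lookup S j)))
      clash (i , j , i<j , level≡) with another (≤-trans (s≤s (s≤s (s≤s z≤n))) ∣S∣>) i j
      ... | k , k≢i , k≢j = sameLevel (lookup S i) (lookup S j) (lookup S k)
        (lookup-≢ i j (λ { refl → <-irrefl refl i<j })) (lookup-≢ k i k≢i) (lookup-≢ k j k≢j)
        (∈-lookup i) (∈-lookup j) (∈-lookup k) level≡

    first : Fin d → Fin (d * suc q)
    first i = combine i zero

    first-≤ : ∀ k → first (ray k) Fin.≤ k
    first-≤ k = begin
      toℕ (first (ray k))                      ≡⟨ Fin.toℕ-combine (ray k) zero ⟩
      suc q * slope k + 0                      ≤⟨ +-monoʳ-≤ (suc q * slope k) z≤n ⟩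
      suc q * slope k + toℕ (position k)       ≡⟨ Fin.toℕ-combine (ray k) (position k) ⟨
      toℕ (combine (ray k) (position k))       ≡⟨ cong toℕ (Fin.combine-remQuot {d} (suc q) k) ⟩
      toℕ k                                    ∎
      where open ≤-Reasoning

    ray-first : ∀ i → ray (first i) ≡ i
    ray-first i = cong proj₁ (Fin.remQuot-combine {d} i zero)

    -- A point strictly between has a smaller abscissa than the first point, yet lies on the same
    -- ray, where numbers and hence abscissas start at the first point.
    first-visible : ∀ i → Visible F point zero (suc (first i))
    first-visible i = (λ ()) , unobstructed
      where
      unobstructed : ∀ j → ¬ InOpenSeg F (point j) (point zero) (point (suc (first i)))
      unobstructed zero j∈ = open≉start (distinct zero (suc (first i)) λ ()) j∈ ≈ₚ-refl
      unobstructed (suc l) (t , 0<t , t<1 , x≈ , y≈) = F.<-irrefl F.refl (F.<-≤-trans l<first first≤l)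
        where
        0<s : 0# F.< fromℕ (abscissa (first i))
        0<s = fromℕ-mono-< (abscissa>0 (first i))
        l<first : fromℕ (abscissa l) F.< fromℕ (abscissa (first i))
        l<first = <-resp-≈ (F.sym (F.trans x≈ (solve 2 (λ t s → :0 :+ t :* (s :- :0) := t :* s) F.refl t _)))
                           (F.*-identityˡ _) (F.*-monoʳ-< 0<s t<1)
        sameRay : ray (first i) ≡ ray l
        sameRay = collinear-origin (first i) l (closed⇒collinear (t , inj₁ 0<t , inj₁ t<1 , x≈ , y≈))
        first≤l : fromℕ (abscissa (first i)) F.≤ fromℕ (abscissa l)
        first≤l = [ (λ lt → inj₁ (fromℕ-mono-< lt)) , (λ eq → inj₂ (reflexive (cong fromℕ eq))) ]′
          (m≤n⇒m<n∨m≡n (^-monoʳ-≤ base (subst (λ j → first j Fin.≤ l) (trans (sym sameRay) (ray-first i)) (first-≤ l))))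

    visible⇒first : ∀ k → Visible F point zero (suc k) → k ≡ first (ray k)
    visible⇒first k (_ , unobstructed) with m≤n⇒m<n∨m≡n (first-≤ k)
    ... | inj₂ eq = sym (Fin.toℕ-injective eq)
    ... | inj₁ first<k = contradiction obstructs (unobstructed (suc (first (ray k))))
      where
      s  = fromℕ (abscissa k)
      s₀ = fromℕ (abscissa (first (ray k)))
      s>0 : 0# F.< s
      s>0 = fromℕ-mono-< (abscissa>0 k)
      obstructs : InOpenSeg F (point (suc (first (ray k)))) (point zero) (point (suc k))
      obstructs with s⁻¹ , ss⁻¹≈1 ← inverse s (>⇒≉ s>0) =
        -- On a ray from the origin the parameter is the quotient of the abscissas; it is below 1
        -- because the first point has the smaller number.
        s₀ F.* s⁻¹ , *-pos (fromℕ-mono-< (abscissa>0 (first (ray k)))) (inverse-pos s>0 ss⁻¹≈1) ,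
        <-resp-≈ F.refl ss⁻¹≈1 (F.*-monoʳ-< (inverse-pos s>0 ss⁻¹≈1) (fromℕ-mono-< (abscissa-mono first<k))) ,
        linear₁ (- s₀) ss⁻¹≈1 (solve 3 (λ s s₀ i → s₀ :- (:0 :+ s₀ :* i :* (s :- :0)) :=
          (:- s₀) :* (s :* i :- :1)) F.refl s s₀ s⁻¹) ,
        F.trans (reflexive (cong (λ i → fromℕ (toℕ i * abscissa (first (ray k)))) (ray-first (ray k))))
          (F.trans (fromℕ-* (slope k) (abscissa (first (ray k))))
            (F.trans (linear₁ (- (s₀ F.* m)) ss⁻¹≈1 (solve 4 (λ s s₀ i m →
                m :* s₀ :- (:0 :+ s₀ :* i :* (m :* s :- :0)) :=
                (:- (s₀ :* m)) :* (s :* i :- :1)) F.refl s s₀ s⁻¹ m))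
              (+-congˡ (*-congˡ (+-congʳ (F.sym (fromℕ-* (slope k) (abscissa k))))))))
        where
        m = fromℕ (slope k)

    degree : HasDegree F point zero d
    degree = map (λ i → suc (first i)) (allFin d) ,
      trans (length-map (λ i → suc (first i)) (allFin d)) (length-tabulate (λ i → i)) ,
      Unique.map⁺ (λ {i} {j} eq → Fin.combine-injectiveˡ i zero j zero (Fin.suc-injective eq)) (Unique.allFin⁺ d) ,
      λ w → mk⇔ seen⇒visible (visible⇒seen w)
      where
      seen⇒visible : ∀ {w} → w ∈ map (λ i → suc (first i)) (allFin d) → Visible F point zero w
      seen⇒visible w∈ with i , _ , refl ← ∈-map⁻ (λ i → suc (first i)) w∈ = first-visible i
      visible⇒seen : ∀ w → Visible F point zero w → w ∈ map (λ i → suc (first i)) (allFin d)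
      visible⇒seen zero    (0≢0 , _) = contradiction refl 0≢0
      visible⇒seen (suc k) visible   =
        subst (λ l → suc l ∈ map (λ i → suc (first i)) (allFin d)) (sym (visible⇒first k visible))
        (∈-map⁺ (λ i → suc (first i)) (∈-allFin (ray k)))

theorem4 : (F : OrderedField) → (ℓ : ℕ) → 2 ≤ ℓ →
    (∀ (n : ℕ) → 2 ≤ n → (p : Fin n → Point F) →
    Distinct F p → AtMostCollinear F p ℓ →
    EdgeConnected F p ⌈ n ∸ 1 / ℓ ∸ 1 ⌉ ×
    (∀ (v w : Fin n) → v ≢ w →
    Σ (Fin ⌈ n ∸ 1 / ℓ ∸ 1 ⌉ → List (Fin n)) λ paths → ((∀ i → OneBendPath F p v w (paths i)) ×
    (∀ i j → i ≢ j → EdgeDisjoint F p (paths i) (paths j)))))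
    × (∀ (n d : ℕ) → 2 ≤ n → d * (ℓ ∸ 1) ≡ n ∸ 1 →
    ∃[ p ] (Distinct F {n} p × AtMostCollinear F p ℓ ×
    ∃[ v ] HasDegree F p v d))
theorem4 F (suc (suc b)) _ =
  (λ n _ p distinct atMost → edgeConnected F p distinct (paths p distinct atMost) , paths p distinct atMost) , sharpness
  where
  paths : ∀ {n} p (distinct : Distinct F {n} p) → AtMostCollinear F p (suc (suc b)) →
    ∀ v w → v ≢ w → EdgeDisjointPaths F p distinct ⌈ n ∸ 1 / suc b ⌉ v w
  paths p distinct atMost v w v≢w = edgeDisjointPaths F p distinct atMost v≢w

  sharpness : ∀ n d → 2 ≤ n → d * suc b ≡ n ∸ 1 →
    ∃[ p ] (Distinct F {n} p × AtMostCollinear F p (suc (suc b)) × ∃[ v ] HasDegree F p v d)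
  -- The equation fixes n as 1 + d (ℓ - 1): the origin and `d` rays of `suc b` points each.
  sharpness (suc _) d _ refl = point , distinct , atMostCollinear , zero , degree
    where open Rays F d b
theorem4 F (suc zero) (s≤s ())
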